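{- For $n\ge4$, $$\sum_{T\in\mathcal{T}_n}\mathbf{x}^{\mathrm{Des}(T)}=\sum_{\pi\in\mathcal{Z}_n}\mathbf{x}^{\mathrm{Des}(\pi)}.$$
   Context: An interval in $\mathbb{Z}$ is a set $[a,b]=\{a,\dots,b\}$; an interval in $\mathbb{Z}_n$ is a subset of $\{1,\dots,n\}$ of the form $[a,b]$ or $[b,n]\cup[1,a]$ with $1\le a\le b\le n$. A permutation $\pi\in\mathcal{S}_n$ is an arc permutation if every prefix set $\{\pi(1),\dots,\pi(j)\}$, $1\le j\le n$, is an interval in $\mathbb{Z}_n$. It is unimodal if either every prefix set $\{\pi(1),\dots,\pi(j)\}$ or every suffix set $\{\pi(j),\dots,\pi(n)\}$, $1\le j\le n$, is an interval in $\mathbb{Z}$. $\mathcal{A}_n$ and $\mathcal{U}_n\subseteq\mathcal{A}_n$ are the sets of arc and unimodal permutations, and $\mathcal{Z}_n=\mathcal{A}_n\setminus\mathcal{U}_n$ is the set of non-unimodal arc permutations. $\mathcal{T}_n$ is the set of standard Young tableaux of shape $(k,2,1^{n-k-2})$ for some $2\le k\le n-2$. $\mathrm{Des}(\pi)=\{i\in\{1,\dots,n-1\}:\pi(i)>\pi(i+1)\}$. For a standard Young tableau $T$ (English notation, rows from top to bottom), $\mathrm{Des}(T)$ is the set of entries $i$ that lie strictly above the row where $i+1$ lies. For a set $D=\{i_1,\dots,i_k\}$, $\mathbf{x}^D=x_{i_1}\cdots x_{i_k}$, where $x_1,x_2,\dots$ are commuting indeterminates. -}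

module Defs where

open import Level using (0ℓ)
open import Data.Nat as ℕ using (ℕ; zero; suc; _∸_)
open import Data.Integer as ℤ using (ℤ)
open import Data.Fin using (Fin; toℕ; _≤_; _<_; _≤?_; _<?_; _≟_)
open import Data.Fin.Properties using (any?; all?)
open import Data.List as List using
  (List; []; _∷_; _++_; map; foldr; filter; concat; concatMap; allFin; upTo; zip;
   length; replicate; cartesianProductWith)
open import Data.List.Membership.Propositional using (_∈_)
open import Data.List.Relation.Unary.All as All using (All)
open import Data.List.Relation.Unary.Linked using (Linked; linked?)
open import Data.List.Relation.Unary.Unique.Propositional as ListU using ()
open import Data.Vec as Vec using (Vec)
import Data.Vec.Properties as Vec
open import Data.Vec.Relation.Unary.Unique.Propositional as VecU using ()
import Data.Vec.Relation.Unary.AllPairs as VecAP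
open import Data.Product using (_×_; _,_; ∃; ∃₂; uncurry)
open import Data.Sum using (_⊎_)
open import Relation.Nullary using (¬_; Dec; ¬?; _×-dec_; _⊎-dec_; _→-dec_)
open import Relation.Nullary.Decidable using (map′)
open import Relation.Unary using (Pred; Decidable; _≐_; _∪_)
open import Relation.Binary.PropositionalEquality using (_≡_)

-- The set {1,…,n} is Fin n throughout: i : Fin n stands for toℕ i + 1, both
-- for positions and for values.  Hence the indeterminates x₁,…,xₙ are also
-- indexed by Fin n.

-- Exponent vectors.
Monomial : ℕ → Set
Monomial n = Vec ℕ n

-- Elements of ℤ[x₁,…,xₙ] as formal sums of terms; repeated monomials and zero
-- coefficients are allowed, and polynomials are compared by _≈_ below, not by _≡_.
Polynomial : ℕ → Set
Polynomial n = List (ℤ × Monomial n)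

infixl 6 _+ᴾ_
infixl 7 _*ᴾ_
infix  4 _≈_

0ᴾ 1ᴾ : ∀ {n} → Polynomial n
0ᴾ = []
1ᴾ = (ℤ.1ℤ , Vec.replicate _ 0) ∷ []

x : ∀ {n} → Fin n → Polynomial n
x i = (ℤ.1ℤ , Vec.replicate _ 0 Vec.[ i ]≔ 1) ∷ []

_+ᴾ_ _*ᴾ_ : ∀ {n} → Polynomial n → Polynomial n → Polynomial n
_+ᴾ_ = _++_
_*ᴾ_ = cartesianProductWith λ (a , u) (b , v) → a ℤ.* b , Vec.zipWith ℕ._+_ u v

coeff : ∀ {n} → Polynomial n → Monomial n → ℤ
coeff p m = foldr ℤ._+_ ℤ.0ℤ
  (map (λ (a , _) → a) (filter (λ (_ , u) → Vec.≡-dec ℕ._≟_ u m) p))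

_≈_ : ∀ {n} → Polynomial n → Polynomial n → Set
p ≈ q = ∀ m → coeff p m ≡ coeff q m

-- Finite sets are given by lists without repetitions.
∑ : ∀ {n} {A : Set} → List A → (A → Polynomial n) → Polynomial n
∑ as f = foldr _+ᴾ_ 0ᴾ (map f as)

𝐱^ : ∀ {n} → List (Fin n) → Polynomial n
𝐱^ D = foldr _*ᴾ_ 1ᴾ (map x D)

≐? : ∀ {n} {P Q : Pred (Fin n) 0ℓ} → Decidable P → Decidable Q → Dec (P ≐ Q)
≐? P? Q? = map′ (λ (f , g) → (λ {i} → f i) , (λ {i} → g i))
                (λ (f , g) → (λ i → f {i}) , (λ i → g {i}))
                (all? (λ i → P? i →-dec Q? i) ×-dec all? (λ i → Q? i →-dec P? i))

[_,_] : ∀ {n} → Fin n → Fin n → Pred (Fin n) 0ℓ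
[ a , b ] i = a ≤ i × i ≤ b

-- [b,n] ∪ [1,a]
wrap : ∀ {n} → Fin n → Fin n → Pred (Fin n) 0ℓ
wrap a b = (b ≤_) ∪ (_≤ a)

-- Only nonempty subsets of {1,…,n} are ever tested, so the endpoints of an
-- interval in ℤ may be taken in {1,…,n}.
IsIntervalℤ : ∀ {n} → Pred (Pred (Fin n) 0ℓ) 0ℓ
IsIntervalℤ S = ∃₂ λ a b → a ≤ b × S ≐ [ a , b ]

IsIntervalℤₙ : ∀ {n} → Pred (Pred (Fin n) 0ℓ) 0ℓ
IsIntervalℤₙ S = ∃₂ λ a b → a ≤ b × (S ≐ [ a , b ] ⊎ S ≐ wrap a b)

isIntervalℤ? : ∀ {n} {S : Pred (Fin n) 0ℓ} → Decidable S → Dec (IsIntervalℤ S)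
isIntervalℤ? S? = any? λ a → any? λ b →
  a ≤? b ×-dec ≐? S? (λ i → a ≤? i ×-dec i ≤? b)

isIntervalℤₙ? : ∀ {n} {S : Pred (Fin n) 0ℓ} → Decidable S → Dec (IsIntervalℤₙ S)
isIntervalℤₙ? S? = any? λ a → any? λ b →
  a ≤? b ×-dec (≐? S? (λ i → a ≤? i ×-dec i ≤? b) ⊎-dec
                ≐? S? (λ i → b ≤? i ⊎-dec i ≤? a))

-- One-line notation.
Word : ℕ → Set
Word n = Vec (Fin n) n

IsPermutation : ∀ {n} → Pred (Word n) 0ℓ
IsPermutation = VecU.Unique

isPermutation? : ∀ {n} → Decidable (IsPermutation {n})
isPermutation? = VecAP.allPairs? λ i j → ¬? (i ≟ j)

prefixSet suffixSet : ∀ {n} → Word n → Fin n → Pred (Fin n) 0ℓ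
prefixSet π j v = ∃ λ i → i ≤ j × Vec.lookup π i ≡ v
suffixSet π j v = ∃ λ i → j ≤ i × Vec.lookup π i ≡ v

prefixSet? : ∀ {n} (π : Word n) j → Decidable (prefixSet π j)
prefixSet? π j v = any? λ i → i ≤? j ×-dec Vec.lookup π i ≟ v

suffixSet? : ∀ {n} (π : Word n) j → Decidable (suffixSet π j)
suffixSet? π j v = any? λ i → j ≤? i ×-dec Vec.lookup π i ≟ v

IsArc IsUnimodal : ∀ {n} → Pred (Word n) 0ℓ
IsArc      π = ∀ j → IsIntervalℤₙ (prefixSet π j)
IsUnimodal π = (∀ j → IsIntervalℤ (prefixSet π j)) ⊎ (∀ j → IsIntervalℤ (suffixSet π j))

isArc? : ∀ {n} → Decidable (IsArc {n})
isArc? π = all? λ j → isIntervalℤₙ? (prefixSet? π j)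

isUnimodal? : ∀ {n} → Decidable (IsUnimodal {n})
isUnimodal? π = all? (λ j → isIntervalℤ? (prefixSet? π j)) ⊎-dec
                all? (λ j → isIntervalℤ? (suffixSet? π j))

allVecs : ∀ {A : Set} → List A → ∀ l → List (Vec A l)
allVecs as zero    = Vec.[] ∷ []
allVecs as (suc l) = cartesianProductWith Vec._∷_ as (allVecs as l)

𝒮 : ∀ n → List (Word n)
𝒮 n = filter isPermutation? (allVecs (allFin n) n)

𝒵 : ∀ n → List (Word n)
𝒵 n = filter (λ π → isArc? π ×-dec ¬? (isUnimodal? π)) (𝒮 n)

-- The last position n is never a descent, since it has no successor.
IsDescent : ∀ {n} → Word n → Pred (Fin n) 0ℓ
IsDescent π i = ∃ λ j → toℕ j ≡ suc (toℕ i) × Vec.lookup π j < Vec.lookup π i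

isDescent? : ∀ {n} (π : Word n) → Decidable (IsDescent π)
isDescent? π i = any? λ j → toℕ j ℕ.≟ suc (toℕ i) ×-dec Vec.lookup π j <? Vec.lookup π i

Des : ∀ {n} → Word n → List (Fin n)
Des π = filter (isDescent? π) (allFin _)

-- A filling is its list of rows, from top to bottom.
Filling : ℕ → Set
Filling n = List (List (Fin n))

fillings : ∀ n → List ℕ → List (Filling n)
fillings n []       = [] ∷ []
fillings n (l ∷ ls) =
  cartesianProductWith _∷_ (map Vec.toList (allVecs (allFin n) l)) (fillings n ls)

-- Since zip truncates to the shorter row, this compares the vertically adjacent
-- entries of two consecutive left-justified rows.
_Above_ : ∀ {n} → List (Fin n) → List (Fin n) → Set
r Above r′ = All (uncurry _<_) (zip r r′)

IsStandard : ∀ {n} → Pred (Filling n) 0ℓ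
IsStandard T = (ListU.Unique (concat T) × (∀ i → i ∈ concat T))
             × All (Linked _<_) T
             × Linked _Above_ T

module _ {n : ℕ} where
  open import Data.List.Membership.DecPropositional (_≟_ {n}) public using (_∈?_)
  open import Data.List.Relation.Unary.AllPairs using (allPairs?)

  isStandard? : Decidable (IsStandard {n})
  isStandard? T =
    (allPairs? (λ i j → ¬? (i ≟ j)) (concat T) ×-dec all? (λ i → i ∈? concat T))
    ×-dec All.all? (linked? _<?_) T
    ×-dec linked? (λ r r′ → All.all? (uncurry _<?_) (zip r r′)) T

SYT : ∀ n → List ℕ → List (Filling n)
SYT n shape = filter isStandard? (fillings n shape)

-- The shapes (k, 2, 1ⁿ⁻ᵏ⁻²) are distinct for distinct k, so the union over k is
-- disjoint.
𝒯 : ∀ n → List (Filling n)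
𝒯 n = concatMap (λ k → SYT n (k ∷ 2 ∷ replicate (n ∸ k ∸ 2) 1))
        (filter (λ k → 2 ℕ.≤? k ×-dec k ℕ.≤? n ∸ 2) (upTo n))

IsDescentᵀ : ∀ {n} → Filling n → Pred (Fin n) 0ℓ
IsDescentᵀ T i = ∃ λ j → toℕ j ≡ suc (toℕ i) ×
  ∃₂ λ r s → r < s × i ∈ List.lookup T r × j ∈ List.lookup T s

isDescentᵀ? : ∀ {n} (T : Filling n) → Decidable (IsDescentᵀ T)
isDescentᵀ? T i = any? λ j → toℕ j ℕ.≟ suc (toℕ i) ×-dec
  any? λ r → any? λ s → r <? s ×-dec i ∈? List.lookup T r ×-dec j ∈? List.lookup T s

Desᵀ : ∀ {n} → Filling n → List (Fin n)
Desᵀ T = filter (isDescentᵀ? T) (allFin _)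

{-# OPTIONS --safe #-}
module Submission where

-- Both statistics are read off a word b of n - 1 bits, bit i saying whether i is
-- a descent; call i an alternation of b if bits i - 1 and i differ.
--
-- In a tableau of near-hook shape, i is a descent when i + 1 lies in the first
-- column below row 1, and is not one when i + 1 lies in row 1; the entry i + 1
-- of cell (2,2) makes i an alternation.  Given b, the tableau is determined by
-- that alternation, which may be any but the first one.
--
-- In an arc permutation, up to the position j where the prefix first contains 1
-- or n every value is a new minimum or maximum of an interval; from then on
-- the suffix is an interval, and each value is its minimum or its maximum.
-- Hence b and j determine the permutation.  If j > 1 then j is an alternation of
-- b; the permutation is unimodal exactly when j = 1 or j is the last alternation.
--
-- So both sides count, for each b, its alternations minus one (if any), and the
-- bijection matches a marked alternation with the one next to it.

open import Defs
open import Level using (0ℓ)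
open import Data.Bool as Bool using (Bool; true; false; not; if_then_else_)
import Data.Bool.Properties as Bool
open import Data.Empty using (⊥; ⊥-elim)
open import Data.Fin as Fin using (Fin; zero; suc; toℕ; fromℕ<)
import Data.Fin.Properties as Fin
import Data.Integer as ℤ
import Data.Integer.Properties as ℤ
open import Data.List as List hiding (lookup; find)
open import Data.List.Properties
open import Data.List.Membership.Propositional using (_∈_; _∉_; find)
open import Data.List.Membership.Propositional.Properties
open import Data.List.Membership.Propositional.Properties.WithK using (unique∧set⇒bag)
open import Data.List.Relation.Binary.BagAndSetEquality using (∼bag⇒↭)
open import Data.List.Relation.Binary.Disjoint.Propositional using (Disjoint)
open import Data.List.Relation.Binary.Permutation.Propositional
  using (_↭_; refl; prep; swap; ↭-trans; ↭-reflexive; ↭-refl)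
  renaming (trans to ↭-step)
import Data.List.Relation.Binary.Permutation.Propositional.Properties as Permutation
open import Data.List.Relation.Binary.Pointwise using (Pointwise; []; _∷_)
open import Data.List.Relation.Unary.All as All using (All; []; _∷_)
import Data.List.Relation.Unary.All.Properties as All
open import Data.List.Relation.Unary.AllPairs as AllPairs using (AllPairs; []; _∷_)
import Data.List.Relation.Unary.AllPairs.Properties as AllPairs
open import Data.List.Relation.Unary.Any as Any using (here; there)
import Data.List.Relation.Unary.Any.Properties as Any
open import Data.List.Relation.Unary.Linked as Linked using (Linked; [-]; _∷_)
import Data.List.Relation.Unary.Linked.Properties as Linked
open import Data.List.Relation.Unary.Unique.Propositional using (Unique)
import Data.List.Relation.Unary.Unique.Propositional.Properties as Unique
open import Data.Nat as ℕ using (ℕ; zero; suc; _+_; _∸_; z≤n; s≤s; s≤s⁻¹)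
import Data.Nat.Properties as ℕ
open import Data.Nat.Tactic.RingSolver using (solve-∀)
open import Data.Product using (_×_; _,_; ∃; ∃₂; proj₁; proj₂)
open import Data.Sum as Sum using (_⊎_; inj₁; inj₂; [_,_]′)
open import Data.Vec as Vec using (Vec; []; _∷_; lookup)
import Data.Vec.Properties as Vec
import Data.Vec.Relation.Unary.All as VecAll
import Data.Vec.Relation.Unary.All.Properties as VecAll
open import Data.Vec.Relation.Unary.AllPairs using ([]; _∷_)
import Data.Vec.Relation.Unary.Unique.Propositional as VecUnique
import Data.Vec.Relation.Unary.Unique.Propositional.Properties as VecUnique
open import Function using (_∘_; flip; id; mk⇔)
open import Relation.Binary.Definitions using (tri<; tri≈; tri>)
open import Relation.Binary.PropositionalEquality hiding ([_])
open import Relation.Nullary using (¬_; Dec; yes; no; does; ¬?; _×-dec_; _⊎-dec_)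
open import Relation.Nullary.Decidable using (dec-true; dec-false)
open import Relation.Unary using (Pred)

-- On the tableau side the excluded alternation comes from the neighbours of cell (2,2). The entry
-- above it lies in the first row, the entry to its left in the first column below row 1; both are
-- smaller than the entry of (2,2) and neither is 1. So both bit values have occurred before it,
-- which forces an earlier alternation, and standardness asks for nothing more. On the permutation
-- side, if the bits from j on are all equal, the suffix is emptied from one side, the other end of
-- {1,...,n} comes last, and every prefix is an interval in ℤ. If they change, some prefix contains
-- both ends but not every value.
--
-- Both objects are therefore cut at the marked place and read outwards from it, with the part
-- before the cut stored in reverse: the reversed prefix of an arc permutation is built by the same
-- peeling as its suffix, only with all comparisons inverted. The correspondence is a relation
-- between the two finite lists, so that no image has to be invented for fillings or words outside
-- them.

private variable
  A B C : Set
  m n : ℕ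

-- Sums of monomials and bijections between finite lists.

concat-↭ : {xss yss : List (List A)} → xss ↭ yss → concat xss ↭ concat yss
concat-↭ refl = ↭-refl
concat-↭ (prep xs p) = Permutation.++⁺ˡ xs (concat-↭ p)
concat-↭ (swap xs ys p) =
  ↭-trans (Permutation.shifts xs ys) (Permutation.++⁺ˡ ys (Permutation.++⁺ˡ xs (concat-↭ p)))
concat-↭ (↭-step p q) = ↭-trans (concat-↭ p) (concat-↭ q)

sum-↭ : {as bs : List ℤ.ℤ} → as ↭ bs → foldr ℤ._+_ ℤ.0ℤ as ≡ foldr ℤ._+_ ℤ.0ℤ bs
sum-↭ refl = refl
sum-↭ (prep a p) = cong (ℤ._+_ a) (sum-↭ p)
sum-↭ {a ∷ b ∷ as} {_ ∷ _ ∷ bs} (swap a b p) = begin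
  a ℤ.+ (b ℤ.+ _)  ≡⟨ ℤ.+-assoc a b _ ⟨
  a ℤ.+ b ℤ.+ _    ≡⟨ cong₂ ℤ._+_ (ℤ.+-comm a b) (sum-↭ p) ⟩
  b ℤ.+ a ℤ.+ _    ≡⟨ ℤ.+-assoc b a _ ⟩
  b ℤ.+ (a ℤ.+ _)  ∎ where open ≡-Reasoning
sum-↭ (↭-step p q) = trans (sum-↭ p) (sum-↭ q)

-- Each coefficient is a sum of integers over the concatenated term lists, so reordering the
-- summands preserves it, although the formal sums differ as lists.
∑-↭ : {as : List A} {bs : List B} {f : A → Polynomial n} {g : B → Polynomial n} →
      map f as ↭ map g bs → ∑ as f ≈ ∑ bs g
∑-↭ p m = sum-↭ (Permutation.map⁺ _ (Permutation.filter-↭ _ (concat-↭ p)))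

module _ {xs : List A} {ys : List B} (R : A → B → Set)
         (xs! : Unique xs) (ys! : Unique ys)
         (total : ∀ {x} → x ∈ xs → ∃ λ y → y ∈ ys × R x y)
         (surjective : ∀ {y} → y ∈ ys → ∃ λ x → x ∈ xs × R x y)
         (functional : ∀ {x y y′} → R x y → R x y′ → y ≡ y′)
         (injective : ∀ {x x′ y} → R x y → R x′ y → x ≡ x′)
         where

  private
    images : ∀ {zs} → (∀ {x} → x ∈ zs → x ∈ xs) → ∃ λ ws → Pointwise R zs ws × All (_∈ ys) ws
    images {[]} _ = [] , [] , []
    images {z ∷ zs} ⊆xs with total (⊆xs (here refl)) | images (⊆xs ∘ there)
    ... | w , w∈ , r | ws , rs , ws∈ = w ∷ ws , r ∷ rs , w∈ ∷ ws∈

    preimage : ∀ {zs ws w} → Pointwise R zs ws → w ∈ ws → ∃ λ z → z ∈ zs × R z w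
    preimage (r ∷ _) (here refl) = _ , here refl , r
    preimage (_ ∷ rs) (there w∈) with preimage rs w∈
    ... | z , z∈ , r = z , there z∈ , r

    image : ∀ {zs ws z} → Pointwise R zs ws → z ∈ zs → ∃ λ w → w ∈ ws × R z w
    image (r ∷ _) (here refl) = _ , here refl , r
    image (_ ∷ rs) (there z∈) with image rs z∈
    ... | w , w∈ , r = w , there w∈ , r

    images-unique : ∀ {zs ws} → Pointwise R zs ws → Unique zs → Unique ws
    images-unique [] [] = []
    images-unique (r ∷ rs) (z∉ ∷ zs!) =
      All.tabulate (λ w∈ → λ { refl → let _ , z∈ , r′ = preimage rs w∈ in
        All.lookup z∉ z∈ (injective r r′) })
      ∷ images-unique rs zs!

    map-images : (d : A → C) (e : B → C) → (∀ {x y} → R x y → d x ≡ e y) →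
                 ∀ {zs ws} → Pointwise R zs ws → map d zs ≡ map e ws
    map-images d e eq [] = refl
    map-images d e eq (r ∷ rs) = cong₂ _∷_ (eq r) (map-images d e eq rs)

  -- Totality yields a list of images of `xs`. Injectivity keeps it free of repetitions;
  -- surjectivity together with functionality makes it exhaust `ys`. Two such lists with the same
  -- members are permutations of each other.
  map-↭-bijection : (d : A → C) (e : B → C) → (∀ {x y} → R x y → d x ≡ e y) →
                    map d xs ↭ map e ys
  map-↭-bijection d e eq with images {xs} (λ x∈ → x∈)
  ... | ws , rs , ws∈ = ↭-trans (↭-reflexive (map-images d e eq rs)) (Permutation.map⁺ e ws↭ys)
    where
    covered : ∀ {y} → y ∈ ys → y ∈ ws
    covered y∈ with surjective y∈
    ... | x , x∈ , r with image rs x∈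
    ... | w , w∈ , r′ = subst (_∈ ws) (functional r′ r) w∈

    ws↭ys : ws ↭ ys
    ws↭ys = ∼bag⇒↭ (unique∧set⇒bag (images-unique rs xs!) ys!
                      (mk⇔ (All.lookup ws∈) covered))

-- Words of bits, and lists cut into a reversed prefix and a suffix.

At : List Bool → ℕ → Set
-- With n letters there are n - 1 consecutive pairs, so the last position falls off the list; it is
-- never a descent.
At []       _       = ⊥
At (b ∷ _)  zero    = b ≡ true
At (_ ∷ bs) (suc k) = At bs k

consecutive : (A → A → B) → List A → List B
consecutive f (a ∷ as@(b ∷ _)) = f a b ∷ consecutive f as
consecutive f _                = []

-- The pair straddling the cut is read off the left-hand list, which is why `y` is put in front of
-- `xs`; pairs there appear backwards, hence `flip`.
consecutive-ʳ++ : (f : A → A → B) (xs : List A) {y : A} {ys : List A} →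
  consecutive f (xs ʳ++ (y ∷ ys)) ≡ consecutive (flip f) (y ∷ xs) ʳ++ consecutive f (y ∷ ys)
consecutive-ʳ++ f []       = refl
consecutive-ʳ++ f (x ∷ xs) = consecutive-ʳ++ f xs

At-consecutive⁺ : (f : A → A → Bool) (F : Fin n → A) {i j : Fin n} →
  toℕ j ≡ suc (toℕ i) → f (F i) (F j) ≡ true → At (consecutive f (tabulate F)) (toℕ i)
At-consecutive⁺ f F {zero}  {suc zero} refl eq = eq
At-consecutive⁺ {n = suc (suc _)} f F {suc i} {suc j} p eq =
  At-consecutive⁺ f (F ∘ suc) (ℕ.suc-injective p) eq

At-consecutive⁻ : (f : A → A → Bool) (F : Fin n → A) (i : Fin n) →
  At (consecutive f (tabulate F)) (toℕ i) → ∃ λ j → toℕ j ≡ suc (toℕ i) × f (F i) (F j) ≡ true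
At-consecutive⁻ {n = suc (suc _)} f F zero eq = suc zero , refl , eq
At-consecutive⁻ {n = suc (suc _)} f F (suc i) at with At-consecutive⁻ f (F ∘ suc) i at
... | j , p , eq = suc j , cong suc p , eq

first-occurrence : {P : A → Set} {xs xs′ : List A} {y y′ : A} {ys ys′ : List A} →
  All (¬_ ∘ P) xs → All (¬_ ∘ P) xs′ → P y → P y′ →
  xs ++ y ∷ ys ≡ xs′ ++ y′ ∷ ys′ → xs ≡ xs′ × y ≡ y′ × ys ≡ ys′
first-occurrence [] [] p p′ refl = refl , refl , refl
first-occurrence [] (¬p ∷ _) p p′ refl = ⊥-elim (¬p p)
first-occurrence (¬p ∷ _) [] p p′ refl = ⊥-elim (¬p p′)
first-occurrence (_ ∷ a) (_ ∷ a′) p p′ eq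
  with refl ← ∷-injectiveˡ eq
  with refl , eq₁ , eq₂ ← first-occurrence a a′ p p′ (∷-injectiveʳ eq) = refl , eq₁ , eq₂

All-reverse : {P : A → Set} {xs : List A} → All P xs → All P (reverse xs)
All-reverse {xs = xs} ps = All.tabulate (λ z∈ →
  All.lookup ps (Permutation.∈-resp-↭ (Permutation.↭-reverse xs) z∈))

-- Makes a cut recoverable from the uncut list. For permutations `P` means being the least or
-- greatest value, for tableaux being the cell `inner`.
first-occurrenceʳ : {P : A → Set} {xs xs′ : List A} {y y′ : A} {ys ys′ : List A} →
  All (¬_ ∘ P) xs → All (¬_ ∘ P) xs′ → P y → P y′ →
  xs ʳ++ (y ∷ ys) ≡ xs′ ʳ++ (y′ ∷ ys′) → xs ≡ xs′ × y ≡ y′ × ys ≡ ys′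
first-occurrenceʳ {xs = xs} {xs′} a a′ p p′ eq
  with eq₁ , eq₂ , eq₃ ← first-occurrence (All-reverse a) (All-reverse a′) p p′
         (trans (sym (ʳ++-defn xs)) (trans eq (ʳ++-defn xs′)))
  = reverse-injective eq₁ , eq₂ , eq₃

replicate-∷-injective : (b : Bool) (k k′ : ℕ) {xs xs′ : List Bool} →
  replicate k b ++ not b ∷ xs ≡ replicate k′ b ++ not b ∷ xs′ → k ≡ k′ × xs ≡ xs′
replicate-∷-injective b zero zero refl = refl , refl
replicate-∷-injective true zero (suc k′) ()
replicate-∷-injective false zero (suc k′) ()
replicate-∷-injective true (suc k) zero ()
replicate-∷-injective false (suc k) zero ()
replicate-∷-injective b (suc k) (suc k′) eq
  with refl , eq′ ← replicate-∷-injective b k k′ (∷-injectiveʳ eq) = refl , eq′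

split-first-not : (b : Bool) {xs : List Bool} → not b ∈ xs →
  ∃₂ λ k ys → xs ≡ replicate k b ++ not b ∷ ys
split-first-not b (here refl) = zero , _ , refl
split-first-not b {x ∷ _} (there b∈) with split-first-not b b∈
split-first-not true  {true ∷ _} _ | k , ys , refl = suc k , ys , refl
split-first-not true  {false ∷ _} _ | k , ys , refl = zero , _ , refl
split-first-not false {false ∷ _} _ | k , ys , refl = suc k , ys , refl
split-first-not false {true ∷ _} _ | k , ys , refl = zero , _ , refl

-- A run of equal letters reads the same in both directions, so it can be carried across the cut.
-- This is what makes the descent words of a matched pair agree.
replicate-ʳ++ : (k : ℕ) (b : A) {xs : List A} {ys : List A} →
  (b ∷ xs) ʳ++ (replicate k b ++ ys) ≡ (replicate k b ++ b ∷ xs) ʳ++ ys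
replicate-ʳ++ zero b = refl
replicate-ʳ++ (suc k) b {xs} {ys} = begin
  xs ʳ++ (b ∷ b ∷ replicate k b ++ ys)        ≡⟨ replicate-ʳ++ k b {b ∷ xs} {ys} ⟩
  (replicate k b ++ b ∷ b ∷ xs) ʳ++ ys        ≡⟨ ++-ʳ++ (replicate k b) ⟩
  xs ʳ++ b ∷ b ∷ replicate k b ʳ++ ys         ≡⟨ cong (λ zs → xs ʳ++ (b ∷ zs)) (comm k ys) ⟩
  xs ʳ++ b ∷ replicate k b ʳ++ (b ∷ ys)       ≡⟨ ++-ʳ++ (replicate k b) ⟨
  (replicate k b ++ b ∷ xs) ʳ++ b ∷ ys        ∎
  where
  open ≡-Reasoning
  comm : ∀ k ys → b ∷ replicate k b ʳ++ ys ≡ replicate k b ʳ++ (b ∷ ys)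
  comm zero ys = refl
  comm (suc k) ys = comm k (b ∷ ys)

∈-ʳ++⁻ : ∀ {v : A} xs {ys} → v ∈ xs ʳ++ ys → v ∈ xs ⊎ v ∈ ys
∈-ʳ++⁻ xs = Sum.swap ∘ Any.reverseAcc⁻ _ xs

∈-ʳ++⁺ˡ : ∀ {v : A} {xs ys} → v ∈ xs → v ∈ xs ʳ++ ys
∈-ʳ++⁺ˡ = Any.reverseAcc⁺ _ _ ∘ inj₂

∈-ʳ++⁺ʳ : ∀ {v : A} xs {ys} → v ∈ ys → v ∈ xs ʳ++ ys
∈-ʳ++⁺ʳ xs = Any.reverseAcc⁺ _ xs ∘ inj₁

unique-ʳ++⁻ʳ : ∀ (xs : List A) {ys} → Unique (xs ʳ++ ys) → Unique ys
unique-ʳ++⁻ʳ []       u = u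
unique-ʳ++⁻ʳ (x ∷ xs) u with _ ∷ ys! ← unique-ʳ++⁻ʳ xs u = ys!

unique-ʳ++-disjoint : ∀ (xs : List A) {ys v} → Unique (xs ʳ++ ys) → v ∈ xs → v ∉ ys
unique-ʳ++-disjoint (x ∷ xs) u (here refl) v∈ys
  with x∉ys ∷ _ ← unique-ʳ++⁻ʳ xs u = All.lookup x∉ys v∈ys refl
unique-ʳ++-disjoint (x ∷ xs) u (there v∈xs) v∈ys =
  unique-ʳ++-disjoint xs u v∈xs (there v∈ys)

unique-ʳ++⁻ˡ : ∀ (xs : List A) {ys} → Unique (xs ʳ++ ys) → Unique xs
unique-ʳ++⁻ˡ []       u = []
unique-ʳ++⁻ˡ (x ∷ xs) u =
  All.tabulate (λ { v∈xs refl → unique-ʳ++-disjoint xs u v∈xs (here refl) })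
  ∷ unique-ʳ++⁻ˡ xs u

unique-ʳ++⁺ : ∀ {xs ys : List A} → Unique xs → Unique ys → (∀ {v} → v ∈ xs → v ∉ ys) →
              Unique (xs ʳ++ ys)
unique-ʳ++⁺ [] ys! _ = ys!
unique-ʳ++⁺ (x∉xs ∷ xs!) ys! disjoint = unique-ʳ++⁺ xs!
  (All.tabulate (λ { v∈ys refl → disjoint (here refl) v∈ys }) ∷ ys!)
  λ { v∈xs (here refl) → All.lookup x∉xs v∈xs refl ; v∈xs (there v∈ys) → disjoint (there v∈xs) v∈ys }

++-split : ∀ (as cs : List A) {bs ds} → as ++ bs ≡ cs ++ ds →
           (∃ λ es → bs ≡ es ++ ds) ⊎ (∃ λ es → as ≡ cs ++ es)
++-split []       cs       eq = inj₁ (cs , eq)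
++-split (a ∷ as) []       eq = inj₂ (a ∷ as , refl)
++-split (a ∷ as) (c ∷ cs) eq with refl ← ∷-injectiveˡ eq =
  Sum.map₂ (λ { (es , refl) → es , refl }) (++-split as cs (∷-injectiveʳ eq))

-- Compares an arbitrary cut with a distinguished one. Either outcome is a tail of one of the stored
-- lists, which is what `ConvexTails` speaks about.
ʳ++-split : ∀ (as cs : List A) {bs ds} → as ʳ++ bs ≡ cs ʳ++ ds →
            (∃ λ es → bs ≡ es ++ ds) ⊎ (∃ λ es → as ≡ es ++ cs)
ʳ++-split as cs eq = Sum.map₂ unreverse
  (++-split (reverse as) (reverse cs) (trans (sym (ʳ++-defn as)) (trans eq (ʳ++-defn cs))))
  where
  unreverse : (∃ λ es → reverse as ≡ reverse cs ++ es) → ∃ λ es → as ≡ es ++ cs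
  unreverse (es , p) = reverse es , (begin
    as                               ≡⟨ reverse-involutive as ⟨
    reverse (reverse as)             ≡⟨ cong reverse p ⟩
    reverse (reverse cs ++ es)       ≡⟨ reverse-++ (reverse cs) es ⟩
    reverse es ++ reverse (reverse cs) ≡⟨ cong (reverse es ++_) (reverse-involutive cs) ⟩
    reverse es ++ cs                 ∎) where open ≡-Reasoning

∈-allVecs : ∀ {l} (v : Vec (Fin n) l) → v ∈ allVecs (allFin n) l
∈-allVecs []      = here refl
∈-allVecs (i ∷ v) = ∈-cartesianProductWith⁺ _∷_ (∈-allFin i) (∈-allVecs v)

allVecs-unique : ∀ {as : List A} → Unique as → ∀ l → Unique (allVecs as l)
allVecs-unique as! zero    = [] ∷ []
allVecs-unique as! (suc l) =
  Unique.cartesianProductWith⁺ _∷_ (λ eq → Vec.∷-injective eq) as! (allVecs-unique as! l)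

-- Arc permutations, built from intervals emptied from their two sides.

module ArcPermutations where

  open import Data.Nat using (_≤_; _<_; _≟_; _<?_; _⊓_)
  open import Data.Nat.Properties hiding (_≟_; _<?_)

  Convex : List ℕ → Set
  Convex xs = ∀ {a b c} → a ∈ xs → c ∈ xs → a ≤ b → b ≤ c → b ∈ xs

  -- The tails of a suffix are the shorter suffixes, those of a reversed prefix the shorter
  -- prefixes, so one notion serves both halves.
  ConvexTails : List ℕ → Set
  ConvexTails xs = ∀ as bs → xs ≡ as ++ bs → Convex bs

  convexTails-∷ : ∀ {x xs} → Convex (x ∷ xs) → ConvexTails xs → ConvexTails (x ∷ xs)
  convexTails-∷ cx cxs []       bs refl = cx
  convexTails-∷ cx cxs (_ ∷ as) bs refl = cxs as bs refl

  -- Each letter of w takes away the minimum (false) or the maximum (true) of what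
  -- is left of [lo, lo + |w|]; hence w is the descent word of peel lo w.
  peel : ℕ → List Bool → List ℕ
  peel lo []          = lo ∷ []
  peel lo (false ∷ w) = lo ∷ peel (suc lo) w
  peel lo (true ∷ w)  = lo + suc (length w) ∷ peel lo w

  length-peel : ∀ lo w → length (peel lo w) ≡ suc (length w)
  length-peel lo []          = refl
  length-peel lo (false ∷ w) = cong suc (length-peel (suc lo) w)
  length-peel lo (true ∷ w)  = cong suc (length-peel lo w)

  peel-∷ : ∀ lo w → ∃₂ λ v vs → peel lo w ≡ v ∷ vs
  peel-∷ lo []          = _ , _ , refl
  peel-∷ lo (false ∷ w) = _ , _ , refl
  peel-∷ lo (true ∷ w)  = _ , _ , refl

  ∈-peel⁻ : ∀ lo w {v} → v ∈ peel lo w → lo ≤ v × v ≤ lo + length w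
  ∈-peel⁻ lo []          (here refl) = ≤-refl , m≤m+n lo 0
  ∈-peel⁻ lo (false ∷ w) (here refl) = ≤-refl , m≤m+n lo _
  ∈-peel⁻ lo (false ∷ w) (there v∈) with lo<v , v≤ ← ∈-peel⁻ (suc lo) w v∈ =
    <⇒≤ lo<v , ≤-trans v≤ (≤-reflexive (sym (+-suc lo _)))
  ∈-peel⁻ lo (true ∷ w)  (here refl) = m≤m+n lo _ , ≤-refl
  ∈-peel⁻ lo (true ∷ w)  (there v∈) with lo≤v , v≤ ← ∈-peel⁻ lo w v∈ =
    lo≤v , ≤-trans v≤ (+-monoʳ-≤ lo (n≤1+n _))

  ∈-peel⁺ : ∀ lo w {v} → lo ≤ v → v ≤ lo + length w → v ∈ peel lo w
  ∈-peel⁺ lo [] lo≤v v≤ = here (≤-antisym (≤-trans v≤ (≤-reflexive (+-identityʳ lo))) lo≤v)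
  ∈-peel⁺ lo (false ∷ w) {v} lo≤v v≤ with m≤n⇒m<n∨m≡n lo≤v
  ... | inj₁ lo<v = there (∈-peel⁺ (suc lo) w lo<v (≤-trans v≤ (≤-reflexive (+-suc lo _))))
  ... | inj₂ refl = here refl
  ∈-peel⁺ lo (true ∷ w) {v} lo≤v v≤ with m≤n⇒m<n∨m≡n v≤
  ... | inj₁ v< = there (∈-peel⁺ lo w lo≤v (s≤s⁻¹ (≤-trans v< (≤-reflexive (+-suc lo _)))))
  ... | inj₂ refl = here refl

  peel-convex : ∀ lo w → Convex (peel lo w)
  peel-convex lo w a∈ c∈ a≤b b≤c = ∈-peel⁺ lo w
    (≤-trans (proj₁ (∈-peel⁻ lo w a∈)) a≤b) (≤-trans b≤c (proj₂ (∈-peel⁻ lo w c∈)))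

  convexTails-[] : ConvexTails []
  convexTails-[] [] .[] refl ()

  peel-convexTails : ∀ lo w → ConvexTails (peel lo w)
  peel-convexTails lo []          = convexTails-∷ (peel-convex lo []) convexTails-[]
  peel-convexTails lo (false ∷ w) =
    convexTails-∷ (peel-convex lo (false ∷ w)) (peel-convexTails (suc lo) w)
  peel-convexTails lo (true ∷ w)  =
    convexTails-∷ (peel-convex lo (true ∷ w)) (peel-convexTails lo w)

  ∉-peel-above : ∀ lo w → lo + suc (length w) ∉ peel lo w
  ∉-peel-above lo w v∈ = <-irrefl refl (≤-trans (≤-reflexive (sym (+-suc lo _))) (proj₂ (∈-peel⁻ lo w v∈)))

  peel-unique : ∀ lo w → Unique (peel lo w)
  peel-unique lo []          = [] ∷ []
  peel-unique lo (false ∷ w) =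
    All.tabulate (λ { v∈ refl → <-irrefl refl (proj₁ (∈-peel⁻ (suc lo) w v∈)) }) ∷ peel-unique (suc lo) w
  peel-unique lo (true ∷ w)  =
    All.tabulate (λ { v∈ refl → ∉-peel-above lo w v∈ }) ∷ peel-unique lo w

  -- Stated for a general `g` because a suffix is read forwards, with `g` the identity, and a prefix
  -- backwards, with `g` equal to `not`.
  consecutive-peel : ∀ {f : ℕ → ℕ → B} {g : Bool → B} →
    (∀ {a b} → a < b → f a b ≡ g false) → (∀ {a b} → b < a → f a b ≡ g true) →
    ∀ lo w → consecutive f (peel lo w) ≡ map g w
  consecutive-peel asc desc lo [] = refl
  consecutive-peel {f = f} asc desc lo (false ∷ w)
    with peel-∷ (suc lo) w | ∈-peel⁻ (suc lo) w | consecutive-peel {f = f} asc desc (suc lo) w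
  ... | v , vs , eq | bounds | ih rewrite eq =
    cong₂ _∷_ (asc (proj₁ (bounds (here refl)))) ih
  consecutive-peel {f = f} asc desc lo (true ∷ w)
    with peel-∷ lo w | ∈-peel⁻ lo w | consecutive-peel {f = f} asc desc lo w
  ... | v , vs , eq | bounds | ih rewrite eq =
    cong₂ _∷_ (desc (≤-trans (s≤s (proj₂ (bounds (here refl)))) (≤-reflexive (sym (+-suc lo _))))) ih

  -- By induction the tail fills `[lo, lo + |w|]`. A new value that keeps the set convex must sit
  -- directly below or directly above this interval.
  convexTails⇒peel : ∀ {x xs} → Unique (x ∷ xs) → ConvexTails (x ∷ xs) → ∃₂ λ lo w → x ∷ xs ≡ peel lo w
  convexTails⇒peel {x} {[]} _ _ = x , [] , refl
  convexTails⇒peel {x} {y ∷ ys} (x∉ ∷ xs!) tails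
    with lo , w , eq ← convexTails⇒peel xs! (λ as bs eq → tails (x ∷ as) bs (cong (x ∷_) eq))
    with convex ← tails [] _ refl
    rewrite eq with <-≤-connex x lo | <-≤-connex (lo + length w) x
  ... | inj₁ x<lo | _ = x , false ∷ w , cong (λ k → x ∷ peel k w) lo≡1+x
    where
    lo≡1+x : lo ≡ suc x
    lo≡1+x with convex {b = suc x} (here refl) (there (∈-peel⁺ lo w ≤-refl (m≤m+n lo _))) (n≤1+n x) x<lo
    ... | there v∈ = ≤-antisym (proj₁ (∈-peel⁻ lo w v∈)) x<lo
  ... | inj₂ lo≤x | inj₂ x≤ = ⊥-elim (All.lookup x∉ (∈-peel⁺ lo w lo≤x x≤) refl)
  ... | inj₂ lo≤x | inj₁ hi<x = lo , true ∷ w , cong (_∷ peel lo w) x≡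
    where
    hi+1≤x : lo + suc (length w) ≤ x
    hi+1≤x = ≤-trans (≤-reflexive (+-suc lo _)) hi<x
    x≡ : x ≡ lo + suc (length w)
    x≡ with convex {b = lo + suc (length w)} (there (∈-peel⁺ lo w ≤-refl (m≤m+n lo _))) (here refl)
             (m≤m+n lo _) hi+1≤x
    ... | here eq = sym eq
    ... | there v∈ = ⊥-elim (∉-peel-above lo w v∈)

  -- Prefix and suffix as complementary sets, and the two ends of the range.

  record Partition (n : ℕ) (xs ys : List ℕ) : Set where
    field
      boundˡ   : ∀ {v} → v ∈ xs → v < n
      boundʳ   : ∀ {v} → v ∈ ys → v < n
      cover    : ∀ {v} → v < n → v ∈ xs ⊎ v ∈ ys
      disjoint : ∀ {v} → v ∈ xs → v ∉ ys
  open Partition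

  partition-sym : ∀ {xs ys} → Partition n xs ys → Partition n ys xs
  partition-sym P = record
    { boundˡ = boundʳ P ; boundʳ = boundˡ P ; cover = Sum.swap ∘ cover P
    ; disjoint = flip (disjoint P) }

  -- Values count from 0 here, so the ends stand for 1 and n.
  End : ℕ → ℕ → Set
  End n e = e ≡ 0 ⊎ suc e ≡ n

  end? : ∀ n e → Dec (End n e)
  end? n e = (e ≟ 0) ⊎-dec (suc e ≟ n)

  -- If a value between `a` and `c` were in `xs`, convexity between it and the end `e` would put `a`
  -- (for `e` = 0) or `c` (for `e` = n - 1) into `xs` as well.
  convex-complement : ∀ {xs ys e} → Partition n xs ys → End n e → e ∈ xs → Convex xs → Convex ys
  convex-complement P end e∈ convex a∈ c∈ a≤b b≤c
    with cover P (≤-<-trans b≤c (boundʳ P c∈)) | end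
  ... | inj₂ b∈ | _ = b∈
  ... | inj₁ b∈ | inj₁ refl = ⊥-elim (disjoint P (convex e∈ b∈ z≤n a≤b) a∈)
  ... | inj₁ b∈ | inj₂ refl =
    ⊥-elim (disjoint P (convex b∈ e∈ b≤c (s≤s⁻¹ (boundʳ P c∈))) c∈)

  record Arrangement (n : ℕ) (L : List ℕ) : Set where
    field
      unique  : Unique L
      bounded : ∀ {v} → v ∈ L → v < n
      full    : ∀ {v} → v < n → v ∈ L
      size    : length L ≡ n
  open Arrangement

  arrangement-partition : ∀ {L} → Arrangement n L → ∀ xs ys → L ≡ xs ʳ++ ys → Partition n xs ys
  arrangement-partition p xs ys refl = record
    { boundˡ = bounded p ∘ ∈-ʳ++⁺ˡ ; boundʳ = bounded p ∘ ∈-ʳ++⁺ʳ xs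
    ; cover = ∈-ʳ++⁻ xs ∘ full p ; disjoint = unique-ʳ++-disjoint xs (unique p) }

  -- A set is an interval in ℤₙ when it or its complement is convex.  The prefix
  -- is kept reversed, in xs.
  Arc PrefixConvex SuffixConvex : List ℕ → Set
  Arc L          = ∀ xs ys → L ≡ xs ʳ++ ys → Convex xs ⊎ Convex ys
  PrefixConvex L = ∀ xs ys → L ≡ xs ʳ++ ys → Convex xs
  SuffixConvex L = ∀ xs ys → L ≡ xs ʳ++ ys → Convex ys

  base : Bool → ℕ → ℕ
  base false k = 0
  base true  k = k

  -- The first and the last value that peel lo (y ∷ y ∷ … ∷ y) takes away from
  -- [lo, lo + k].
  start finish : Bool → ℕ → ℕ → ℕ
  start  y lo k = if y then lo + k else lo
  finish y = start (not y)

  -- The prefix up to the first occurrence of 0 (y = false) or n - 1 (y = true),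
  -- peeled backwards from that value, followed by the rest, peeled forwards.
  layout : Bool → List Bool → List Bool → List ℕ
  layout y w h =
    peel (base y (suc (length h))) (y ∷ w) ʳ++ peel (base (not y) (2 + length w)) h

  finish∈peel : ∀ y lo w → finish y lo (length w) ∈ peel lo w
  finish∈peel true  lo w = ∈-peel⁺ lo w ≤-refl (m≤m+n lo _)
  finish∈peel false lo w = ∈-peel⁺ lo w (m≤m+n lo _) ≤-refl

  -- Repeating `y` removes values from one side only, so the extreme value of the other side stays
  -- to the very end.
  finish∈peel-tail : ∀ y lo w as b bs → All (_≡ y) w → peel lo w ≡ as ++ b ∷ bs →
                     finish y lo (length w) ∈ b ∷ bs
  finish∈peel-tail y lo w [] b bs _ eq = subst (finish y lo (length w) ∈_) eq (finish∈peel y lo w)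
  finish∈peel-tail y lo [] (_ ∷ []) b bs _ ()
  finish∈peel-tail y lo [] (_ ∷ _ ∷ as) b bs _ ()
  finish∈peel-tail .false lo (false ∷ w) (_ ∷ as) b bs (refl ∷ ws) eq =
    subst (_∈ b ∷ bs) (sym (+-suc lo _)) (finish∈peel-tail false (suc lo) w as b bs ws (∷-injectiveʳ eq))
  finish∈peel-tail .true lo (true ∷ w) (_ ∷ as) b bs (refl ∷ ws) eq =
    finish∈peel-tail true lo w as b bs ws (∷-injectiveʳ eq)

  -- The first `not y` removes exactly the value that repeating `y` would leave for last. Something
  -- still follows, because `peel` yields one value more than the word has letters.
  finish∈peel-init : ∀ y lo w → not y ∈ w →
    ∃₂ λ as b → ∃ λ bs → peel lo w ≡ as ++ b ∷ bs × finish y lo (length w) ∈ as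
  finish∈peel-init y lo (x ∷ w) y∈ with x Bool.≟ not y | y∈
  finish∈peel-init true lo (false ∷ w) _ | yes refl | _
    with v , vs , eq ← peel-∷ (suc lo) w = lo ∷ [] , v , vs , cong (lo ∷_) eq , here refl
  finish∈peel-init false lo (true ∷ w) _ | yes refl | _
    with v , vs , eq ← peel-∷ lo w = _ ∷ [] , v , vs , cong (lo + suc (length w) ∷_) eq , here refl
  ... | no x≢ | here eq = ⊥-elim (x≢ (sym eq))
  finish∈peel-init true lo (true ∷ w) _ | no _ | there y∈
    with as , b , bs , eq , f∈ ← finish∈peel-init true lo w y∈ =
    _ ∷ as , b , bs , cong (lo + suc (length w) ∷_) eq , there f∈
  finish∈peel-init true lo (false ∷ w) _ | no x≢ | there y∈ = ⊥-elim (x≢ refl)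
  finish∈peel-init false lo (false ∷ w) _ | no _ | there y∈
    with as , b , bs , eq , f∈ ← finish∈peel-init false (suc lo) w y∈ =
    _ ∷ as , b , bs , cong (lo ∷_) eq , there (subst (_∈ as) (sym (+-suc lo _)) f∈)
  finish∈peel-init false lo (true ∷ w) _ | no x≢ | there y∈ = ⊥-elim (x≢ refl)

  ¬∈⇒All : ∀ y {h} → not y ∉ h → All (_≡ y) h
  ¬∈⇒All y {[]} _ = []
  ¬∈⇒All y {x ∷ h} ∉ with x Bool.≟ y
  ... | yes eq = eq ∷ ¬∈⇒All y (∉ ∘ there)
  ... | no x≢y = ⊥-elim (∉ (here (sym (Bool.¬-not x≢y))))

  -- With `2 ≤ n` the ends 0 and n - 1 differ, so a single value cannot use up both.
  other-end : ∀ {n} v → 2 ≤ n → ∃ λ o → End n o × o < n × o ≢ v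
  other-end zero    (s≤s (s≤s z≤n)) = _ , inj₂ refl , ≤-refl , λ ()
  other-end (suc v) 2≤n             = 0 , inj₁ refl , <⇒≤ 2≤n , λ ()

  -- From arc permutations to layouts.

  module _ {L} (p : Arrangement n L) (2≤n : 2 ≤ n) (arc : Arc L) where

    convex-prefix : ∀ xs {ys e} → L ≡ xs ʳ++ ys → End n e → e ∈ ys → Convex xs
    convex-prefix xs eq end e∈ with arc xs _ eq
    ... | inj₁ convex = convex
    ... | inj₂ convex = convex-complement (partition-sym (arrangement-partition p xs _ eq)) end e∈ convex

    convex-suffix : ∀ xs {ys e} → L ≡ xs ʳ++ ys → End n e → e ∈ xs → Convex ys
    convex-suffix xs eq end e∈ with arc xs _ eq
    ... | inj₁ convex = convex-complement (arrangement-partition p xs _ eq) end e∈ convex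
    ... | inj₂ convex = convex

    -- While no end has occurred, adding `z` can use up only one of the two. The other is still in
    -- the suffix, so the prefix with `z` is convex even if `z` is an end.
    first-end : ∀ xs zs → L ≡ xs ʳ++ zs → All (¬_ ∘ End n) xs → ConvexTails xs →
      ∃₂ λ e xs′ → ∃ λ zs′ → L ≡ (e ∷ xs′) ʳ++ zs′ × End n e × ConvexTails (e ∷ xs′)
    first-end xs [] eq inner tails
      with ∈-ʳ++⁻ xs (subst (0 ∈_) eq (full p (<⇒≤ 2≤n)))
    ... | inj₁ 0∈ = ⊥-elim (All.lookup inner 0∈ (inj₁ refl))
    first-end xs (z ∷ zs) eq inner tails = go (end? n z)
      where
      later-end : ∃ λ o → End n o × o ∈ zs
      later-end with o , end , o<n , o≢z ← other-end z 2≤n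
        with ∈-ʳ++⁻ xs (subst (o ∈_) eq (full p o<n))
      ... | inj₁ o∈           = ⊥-elim (All.lookup inner o∈ end)
      ... | inj₂ (here o≡z)   = ⊥-elim (o≢z o≡z)
      ... | inj₂ (there o∈)   = o , end , o∈
      tails′ : ConvexTails (z ∷ xs)
      tails′ with o , end , o∈ ← later-end = convexTails-∷ (convex-prefix (z ∷ xs) eq end o∈) tails
      go : Dec (End n z) → _
      go (yes end) = z , xs , zs , eq , end , tails′
      go (no ¬end) = first-end (z ∷ xs) zs eq (¬end ∷ inner) tails′

    suffix-tails : ∀ xs {zs e} → L ≡ xs ʳ++ zs → End n e → e ∈ xs → ConvexTails zs
    suffix-tails xs eq end e∈ as bs refl =
      convex-suffix (as ʳ++ xs) (trans eq (sym (ʳ++-ʳ++ as))) end (∈-ʳ++⁺ʳ as e∈)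

    full-convex : Convex L
    full-convex _ c∈ _ b≤c = full p (≤-<-trans b≤c (bounded p c∈))

    starts-at-end⇒suffixConvex : ∀ {e zs} → L ≡ e ∷ zs → End n e → SuffixConvex L
    starts-at-end⇒suffixConvex {e} {zs} eq end xs ys eq′ with reverse xs | trans (sym (ʳ++-defn xs)) (sym eq′)
    ... | []     | refl = full-convex
    ... | c ∷ cs | eq″ = suffix-tails (e ∷ []) eq end (here refl) cs ys
                           (∷-injectiveʳ (trans (sym eq) (sym eq″)))

    -- A cut inside `zs` leaves the end `f` in the suffix, which forces the prefix to be convex; for
    -- an earlier cut the prefix is a tail of `xs`.
    final-end⇒prefixConvex : ∀ xs zs → L ≡ xs ʳ++ zs → ConvexTails xs → ConvexTails zs →
      ∀ {f} → End n f → (∀ as b bs → zs ≡ as ++ b ∷ bs → f ∈ b ∷ bs) → PrefixConvex L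
    final-end⇒prefixConvex xs zs eq xs-tails zs-tails end f∈ as [] eq′ _ c∈ _ b≤c
      with ∈-ʳ++⁻ as (subst (_ ∈_) eq′ (full p (≤-<-trans b≤c (boundˡ (arrangement-partition p as [] eq′) c∈))))
    ... | inj₁ b∈ = b∈
    final-end⇒prefixConvex xs zs eq xs-tails zs-tails end f∈ as (b ∷ bs) eq′
      with ʳ++-split xs as (trans (sym eq) eq′)
    ... | inj₁ (es , eq″) = convex-prefix as eq′ end (f∈ es b bs eq″)
    ... | inj₂ (es , eq″) = xs-tails es as eq″

  next : Bool → ℕ → ℕ
  next y lo = if y then lo else suc lo

  peel-start : ∀ y lo w → peel lo (y ∷ w) ≡ start y lo (suc (length w)) ∷ peel (next y lo) w
  peel-start true  lo w = refl
  peel-start false lo w = refl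

  suc+suc : ∀ m n → suc m + suc n ≡ 2 + (n + m)
  suc+suc m n = cong suc (trans (+-suc m n) (cong suc (+-comm m n)))

  -- An interval of known length with a known end of the range at its border has only one possible
  -- position, and the other interval must fill the rest.
  layout-bases : ∀ y lo w lo′ h → Partition n (peel lo (y ∷ w)) (peel lo′ h) →
    End n (start y lo (suc (length w))) → n ≡ 3 + (length w + length h) →
    lo ≡ base y (suc (length h)) × lo′ ≡ base (not y) (2 + length w)
  layout-bases false lo w lo′ h P (inj₁ refl) refl = refl , ≤-antisym upper lower
    where
    upper : lo′ ≤ 2 + length w
    upper with cover P {2 + length w} (s≤s (s≤s (s≤s (m≤m+n _ _))))
    ... | inj₁ v∈ = ⊥-elim (<-irrefl refl (proj₂ (∈-peel⁻ 0 (false ∷ w) v∈)))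
    ... | inj₂ v∈ = proj₁ (∈-peel⁻ lo′ h v∈)
    lower : 2 + length w ≤ lo′
    lower = ≮⇒≥ λ lt → disjoint P (∈-peel⁺ 0 (false ∷ w) z≤n (s≤s⁻¹ lt))
                                  (∈-peel⁺ lo′ h ≤-refl (m≤m+n _ _))
  -- If the minimum `lo` of the prefix were n - 1, there would be no room for its other values, and
  -- it has at least two.
  layout-bases false lo w lo′ h P (inj₂ refl) _ = ⊥-elim (m+1+n≰m lo
    (s≤s⁻¹ (boundˡ P (∈-peel⁺ lo (false ∷ w) (m≤m+n _ _) ≤-refl))))
  layout-bases true lo w lo′ h P (inj₁ eq) _ = ⊥-elim (m+1+n≢0 lo eq)
  layout-bases true lo w lo′ h P (inj₂ eq) n≡
    with refl ← +-cancelʳ-≡ (suc (length w)) lo (suc (length h))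
           (suc-injective (trans eq (trans n≡ (cong suc (sym (suc+suc (length h) (length w)))))))
    with cover P {0} (≤-trans (s≤s z≤n) (≤-reflexive eq))
  ... | inj₁ 0∈ with () ← proj₁ (∈-peel⁻ (suc (length h)) (true ∷ w) 0∈)
  ... | inj₂ 0∈ = refl , n≤0⇒n≡0 (proj₁ (∈-peel⁻ lo′ h 0∈))

  peel-sizes : ∀ lo g lo′ h → length (peel lo g ʳ++ peel lo′ h) ≡ 2 + (length g + length h)
  peel-sizes lo g lo′ h = begin
    length (peel lo g ʳ++ peel lo′ h)          ≡⟨ length-ʳ++ (peel lo g) ⟩
    length (peel lo g) + length (peel lo′ h)   ≡⟨ cong₂ _+_ (length-peel lo g) (length-peel lo′ h) ⟩
    suc (length g) + suc (length h)            ≡⟨ cong suc (+-suc _ _) ⟩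
    2 + (length g + length h)                  ∎
    where open ≡-Reasoning

  IsLayout : ℕ → List ℕ → Bool → List Bool → List Bool → Set
  IsLayout n L y w h = L ≡ layout y w h × not y ∈ h × n ≡ 3 + (length w + length h)

  -- Cut right after the first end. If that end stands in first place, all suffixes are convex; if
  -- nothing follows it, or the rest is peeled by `y` alone, all prefixes are. The two negated
  -- hypotheses exclude exactly these cases.
  arc⇒layout : ∀ {L} → Arrangement n L → 2 ≤ n → Arc L → ¬ PrefixConvex L → ¬ SuffixConvex L →
    ∃ λ y → ∃₂ λ w h → IsLayout n L y w h
  arc⇒layout {n} {L} p 2≤n arc ¬prefix ¬suffix = go (first-end p 2≤n arc [] L refl [] convexTails-[])
    where
    classify : ∀ e lo g lo′ h → L ≡ peel lo g ʳ++ peel lo′ h → End n e →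
               (∃ λ xs → peel lo g ≡ e ∷ xs) → ∃ λ y → ∃₂ λ w h → IsLayout n L y w h
    classify e lo [] lo′ h eq end (_ , refl) = ⊥-elim (¬suffix (starts-at-end⇒suffixConvex p 2≤n arc eq end))
    classify e lo (y ∷ w) lo′ h eq end (_ , eq₁)
      with refl ← ∷-injectiveˡ (trans (sym (peel-start y lo w)) eq₁)
      with n≡ ← trans (sym (size p)) (trans (cong length eq) (peel-sizes lo (y ∷ w) lo′ h))
      with refl , refl ← layout-bases y lo w lo′ h (arrangement-partition p (peel lo (y ∷ w)) _ eq) end n≡
      = y , w , h , eq , mixed , n≡
      where
      final-end : ∀ y w → n ≡ 3 + (length w + length h) →
                  End n (finish y (base (not y) (2 + length w)) (length h))
      final-end false w n≡ = inj₂ (sym n≡)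
      final-end true  w n≡ = inj₁ refl
      mixed : not y ∈ h
      mixed with Any.any? (not y Bool.≟_) h
      ... | yes y∈ = y∈
      ... | no  y∉ = ⊥-elim (¬prefix (final-end⇒prefixConvex p 2≤n arc _ _ eq
              (peel-convexTails _ (y ∷ w)) (peel-convexTails _ h) (final-end y w n≡)
              (λ as b bs → finish∈peel-tail y _ h as b bs (¬∈⇒All y y∉))))

    go : _ → _
    go (e , xs , [] , eq , end , tails) = ⊥-elim (¬prefix
      (final-end⇒prefixConvex p 2≤n arc (e ∷ xs) [] eq tails convexTails-[] end
        λ { [] b bs () ; (_ ∷ _) b bs () }))
    go (e , xs , z ∷ zs , eq , end , tails)
      with lo , g , eq₁ ← convexTails⇒peel (unique-ʳ++⁻ˡ (e ∷ xs) (subst Unique eq (unique p))) tails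
      with lo′ , h , eq₂ ← convexTails⇒peel (unique-ʳ++⁻ʳ (e ∷ xs) (subst Unique eq (unique p)))
                             (suffix-tails p 2≤n arc (e ∷ xs) eq end (here refl))
      = classify e lo g lo′ h (trans eq (cong₂ _ʳ++_ eq₁ eq₂)) end (xs , sym eq₁)

  -- Descents of a layout.

  _>ᵇ_ : ℕ → ℕ → Bool
  a >ᵇ b = does (b <? a)

  >ᵇ-asc : ∀ {a b} → a < b → a >ᵇ b ≡ false
  >ᵇ-asc {a} {b} lt = dec-false (b <? a) (<⇒≯ lt)

  >ᵇ-desc : ∀ {a b} → b < a → a >ᵇ b ≡ true
  >ᵇ-desc {a} {b} lt = dec-true (b <? a) lt

  descents-peel : ∀ lo w → consecutive _>ᵇ_ (peel lo w) ≡ w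
  descents-peel lo w = trans
    (consecutive-peel {g = λ b → b} (λ {a} {b} → >ᵇ-asc {a} {b}) (λ {a} {b} → >ᵇ-desc {a} {b}) lo w) (map-id w)

  -- The value at the cut is 0 or n - 1, so it compares in the same way with whatever follows, and
  -- the bit there is `y`. Bits before the cut are read backwards and hence negated; the one just
  -- before it is `not y`, so the cut is an alternation.
  descents-layout : ∀ y w h → consecutive _>ᵇ_ (layout y w h) ≡ (y ∷ not y ∷ map not w) ʳ++ h
  descents-layout y w h = go (peel-∷ (base (not y) (2 + length w)) h)
    where
    lo = base y (suc (length h))
    lo′ = base (not y) (2 + length w)
    link : ∀ y w z → z ∈ peel (base (not y) (2 + length w)) h →
           start y (base y (suc (length h))) (suc (length w)) >ᵇ z ≡ y
    link false w z z∈ = dec-false (z <? 0) λ ()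
    link true  w z z∈ = dec-true (z <? _) (≤-trans (s≤s (proj₂ (∈-peel⁻ 0 h z∈))) (m≤m+n _ _))
    first : ∀ z → z ∈ peel lo′ h →
            consecutive (flip _>ᵇ_) (z ∷ peel lo (y ∷ w)) ≡ y ∷ not y ∷ map not w
    first z z∈ with consecutive-peel {f = flip _>ᵇ_} {g = not}
      (λ {a} {b} → >ᵇ-desc {b} {a}) (λ {a} {b} → >ᵇ-asc {b} {a}) lo (y ∷ w)
    ... | eq rewrite peel-start y lo w = cong₂ _∷_ (link y w z z∈) eq
    go : _ → consecutive _>ᵇ_ (layout y w h) ≡ (y ∷ not y ∷ map not w) ʳ++ h
    go (z , zs , eq) = begin
      consecutive _>ᵇ_ (peel lo (y ∷ w) ʳ++ peel lo′ h)
        ≡⟨ cong (λ vs → consecutive _>ᵇ_ (peel lo (y ∷ w) ʳ++ vs)) eq ⟩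
      consecutive _>ᵇ_ (peel lo (y ∷ w) ʳ++ (z ∷ zs))
        ≡⟨ consecutive-ʳ++ _>ᵇ_ (peel lo (y ∷ w)) ⟩
      consecutive (flip _>ᵇ_) (z ∷ peel lo (y ∷ w)) ʳ++ consecutive _>ᵇ_ (z ∷ zs)
        ≡⟨ cong₂ _ʳ++_ (first z (subst (z ∈_) (sym eq) (here refl)))
             (trans (cong (consecutive _>ᵇ_) (sym eq))
                    (descents-peel lo′ h)) ⟩
      (y ∷ not y ∷ map not w) ʳ++ h ∎
      where open ≡-Reasoning

  -- Needed to recognise the cut as the first occurrence of an end.
  layout-inner : ∀ y (w h : List Bool) → n ≡ 3 + (length w + length h) →
                 All (¬_ ∘ End n) (peel (next y (base y (suc (length h)))) w)
  layout-inner false w h refl = All.tabulate λ v∈ → λ where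
    (inj₁ refl) → n≮0 (proj₁ (∈-peel⁻ 1 w v∈))
    (inj₂ refl) → m+n≮m (length w) (length h) (s≤s⁻¹ (proj₂ (∈-peel⁻ 1 w v∈)))
  layout-inner true w h refl = All.tabulate λ v∈ → λ where
    (inj₁ refl) → n≮0 (proj₁ (∈-peel⁻ (suc (length h)) w v∈))
    (inj₂ refl) → <-irrefl refl (≤-trans (s≤s⁻¹ (proj₂ (∈-peel⁻ (suc (length h)) w v∈)))
                                         (≤-reflexive (+-comm (length h) (length w))))

  ∷-snoc : ∀ {A : Set} (x : A) xs → ∃₂ λ vs v → x ∷ xs ≡ vs ++ v ∷ []
  ∷-snoc x []       = [] , x , refl
  ∷-snoc x (y ∷ ys) with vs , v , eq ← ∷-snoc y ys = x ∷ vs , v , cong (x ∷_) eq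

  peel-snoc : ∀ lo w → ∃₂ λ vs v → peel lo w ≡ vs ++ v ∷ []
  peel-snoc lo w with u , us , eq ← peel-∷ lo w rewrite eq = ∷-snoc u us

  peel-injective : ∀ {lo w lo′ w′} → peel lo w ≡ peel lo′ w′ → w ≡ w′
  peel-injective {lo} {w} {lo′} {w′} eq = begin
    w                                   ≡⟨ bits lo w ⟨
    consecutive _>ᵇ_ (peel lo w)        ≡⟨ cong (consecutive _>ᵇ_) eq ⟩
    consecutive _>ᵇ_ (peel lo′ w′)      ≡⟨ bits lo′ w′ ⟩
    w′                                  ∎
    where
    open ≡-Reasoning
    bits = descents-peel

  -- Layouts are non-unimodal arc permutations with unique data.

  start-end : ∀ y (w h : List Bool) →
    End (3 + (length w + length h)) (start y (base y (suc (length h))) (suc (length w)))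
  start-end false w h = inj₁ refl
  start-end true  w h = inj₂ (cong suc (suc+suc (length h) (length w)))

  -- The two given members are 0 and n - 1, in an order that depends on `y`.
  spanning : ∀ y (w h : List Bool) {xs} → Convex xs → start y (base y (suc (length h))) (suc (length w)) ∈ xs →
    finish y (base (not y) (2 + length w)) (length h) ∈ xs →
    ∀ {v} → v < 3 + (length w + length h) → v ∈ xs
  spanning false w h convex s∈ f∈ v<n = convex s∈ f∈ z≤n (s≤s⁻¹ v<n)
  spanning true  w h convex s∈ f∈ v<n = convex f∈ s∈ z≤n
    (≤-trans (s≤s⁻¹ v<n) (≤-reflexive (sym (suc+suc (length h) (length w)))))

  layout-partition : ∀ y (w h : List Bool) → Partition (3 + (length w + length h))
    (peel (base y (suc (length h))) (y ∷ w)) (peel (base (not y) (2 + length w)) h)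
  layout-partition false w h = record
    { boundˡ = λ v∈ → ≤-trans (s≤s (proj₂ (∈-peel⁻ 0 (false ∷ w) v∈))) (s≤s (s≤s (m≤n⇒m≤1+n (m≤m+n _ _))))
    ; boundʳ = λ v∈ → s≤s (proj₂ (∈-peel⁻ (2 + length w) h v∈))
    ; cover = λ {v} v<N → Sum.map
      (λ lt → ∈-peel⁺ 0 (false ∷ w) z≤n (s≤s⁻¹ lt))
      (λ le → ∈-peel⁺ (2 + length w) h le (s≤s⁻¹ v<N))
      (<-≤-connex v (2 + length w))
    ; disjoint = λ v∈ v∈′ → <-irrefl refl
      (≤-trans (proj₁ (∈-peel⁻ (2 + length w) h v∈′)) (proj₂ (∈-peel⁻ 0 (false ∷ w) v∈))) }
  layout-partition true w h = record
    { boundˡ = λ v∈ → s≤s (≤-trans (proj₂ (∈-peel⁻ (suc (length h)) (true ∷ w) v∈))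
                                  (≤-reflexive (suc+suc (length h) (length w))))
    ; boundʳ = λ v∈ → s≤s (≤-trans (proj₂ (∈-peel⁻ 0 h v∈)) (≤-trans (m≤n+m _ _) (≤-trans (n≤1+n _) (n≤1+n _))))
    ; cover = λ {v} v<N → Sum.map
      (λ le → ∈-peel⁺ (suc (length h)) (true ∷ w) le
               (≤-trans (s≤s⁻¹ v<N) (≤-reflexive (sym (suc+suc (length h) (length w))))))
      (λ lt → ∈-peel⁺ 0 h z≤n (s≤s⁻¹ lt))
      (≤-<-connex (suc (length h)) v)
    ; disjoint = λ v∈ v∈′ → <-irrefl refl
      (≤-trans (proj₁ (∈-peel⁻ (suc (length h)) (true ∷ w) v∈)) (proj₂ (∈-peel⁻ 0 h v∈′))) }

  module _ (y : Bool) (w h : List Bool) where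
    private
      lo  = base y (suc (length h))
      lo′ = base (not y) (2 + length w)

    layout-arrangement : Arrangement (3 + (length w + length h)) (layout y w h)
    layout-arrangement = record
      { unique = unique-ʳ++⁺ (peel-unique lo (y ∷ w)) (peel-unique lo′ h) (disjoint (layout-partition y w h))
      ; bounded = [ boundˡ (layout-partition y w h) , boundʳ (layout-partition y w h) ]′ ∘ ∈-ʳ++⁻ (peel lo (y ∷ w))
      ; full = [ ∈-ʳ++⁺ˡ , ∈-ʳ++⁺ʳ (peel lo (y ∷ w)) ]′ ∘ cover (layout-partition y w h)
      ; size = peel-sizes lo (y ∷ w) lo′ h }

    layout-arc : Arc (layout y w h)
    layout-arc as bs eq with ʳ++-split (peel lo (y ∷ w)) as eq
    ... | inj₁ (es , eq′) = inj₂ (peel-convexTails lo′ h es bs eq′)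
    ... | inj₂ (es , eq′) = inj₁ (peel-convexTails lo (y ∷ w) es as eq′)

    -- The prefix up to the cut has at least two values, so dropping the very first value `t` keeps
    -- both ends in the suffix; a convex suffix would then contain `t` too.
    layout-¬suffixConvex : ¬ SuffixConvex (layout y w h)
    layout-¬suffixConvex convex with ts , t , eq ← peel-snoc (next y lo) w =
      disjoint P (here refl) (spanning y w h (convex (t ∷ []) _ eq′) (∈-ʳ++⁺ˡ {xs = s ∷ ts} (here refl))
        (∈-ʳ++⁺ʳ (s ∷ ts) (finish∈peel y lo′ h)) (boundˡ P (here refl)))
      where
      s = start y lo (suc (length w))
      eq′ : layout y w h ≡ (t ∷ []) ʳ++ ((s ∷ ts) ʳ++ peel lo′ h)
      eq′ = trans (cong (_ʳ++ peel lo′ h) (trans (peel-start y lo w) (cong (s ∷_) eq)))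
                  (++-ʳ++ (s ∷ ts))
      P = arrangement-partition layout-arrangement (t ∷ []) _ eq′

    -- Because of `not y`, the second end is reached before the last value, so some prefix contains
    -- both ends and still misses `b`.
    layout-¬prefixConvex : not y ∈ h → ¬ PrefixConvex (layout y w h)
    layout-¬prefixConvex y∈ convex
      with as , b , bs , eq , f∈ ← finish∈peel-init y lo′ h y∈ =
      disjoint P (spanning y w h (convex xs _ eq′) s∈ (∈-ʳ++⁺ˡ {xs = as} f∈) (boundʳ P (here refl))) (here refl)
      where
      xs = as ʳ++ peel lo (y ∷ w)
      eq′ : layout y w h ≡ xs ʳ++ (b ∷ bs)
      eq′ = trans (cong (peel lo (y ∷ w) ʳ++_) eq) (sym (ʳ++-ʳ++ as))
      P = arrangement-partition layout-arrangement xs (b ∷ bs) eq′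
      s∈ : start y lo (suc (length w)) ∈ xs
      s∈ = ∈-ʳ++⁺ʳ as (subst (start y lo (suc (length w)) ∈_) (sym (peel-start y lo w)) (here refl))

  -- The first end locates the cut, each half returns its word as its descent word, and the value at
  -- the cut reveals `y`: it is 0 for `false` and positive for `true`.
  layout-injective : ∀ {L} y w h y′ w′ h′ → IsLayout n L y w h → IsLayout n L y′ w′ h′ →
                     y ≡ y′ × w ≡ w′ × h ≡ h′
  layout-injective y w h y′ w′ h′ (refl , _ , refl) (eq , _ , n≡)
    with eqʷ , eqˢ , eqʰ ← first-occurrenceʳ (layout-inner y w h refl) (layout-inner y′ w′ h′ n≡)
           (start-end y w h) (subst (λ m → End m (start y′ (base y′ (suc (length h′))) (suc (length w′)))) (sym n≡)
             (start-end y′ w′ h′))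
           (trans (cong (_ʳ++ peel (base (not y) (2 + length w)) h) (sym (peel-start y _ w)))
             (trans eq (cong (_ʳ++ peel (base (not y′) (2 + length w′)) h′) (peel-start y′ _ w′))))
    with refl ← peel-injective {w = w} eqʷ | refl ← peel-injective {w = h} eqʰ
    = same-end y y′ {l = length w} {l′ = length w} eqˢ , refl , refl
    where
    same-end : ∀ y y′ {k k′ l l′} → start y (base y k) (suc l) ≡ start y′ (base y′ k′) (suc l′) →
               y ≡ y′
    same-end false false _  = refl
    same-end true  true  _  = refl
    same-end false true {k′ = k′} eq = ⊥-elim (m+1+n≢0 k′ (sym eq))
    same-end true false {k} eq = ⊥-elim (m+1+n≢0 k eq)

  -- Translation between words over `Fin n` and lists of naturals.

  fromBound : ∀ {v} → v < n → ∃ λ (i : Fin n) → toℕ i ≡ v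
  fromBound v<n = fromℕ< v<n , Fin.toℕ-fromℕ< v<n

  ∈-tabulate-prefix⁻ : (F : Fin m → B) → ∀ as {bs v} → tabulate F ≡ as ++ bs → v ∈ as →
                       ∃ λ i → toℕ i < length as × F i ≡ v
  ∈-tabulate-prefix⁻ {suc m} F (a ∷ as) eq (here refl) = zero , s≤s z≤n , ∷-injectiveˡ eq
  ∈-tabulate-prefix⁻ {suc m} F (a ∷ as) eq (there v∈)
    with i , lt , eq′ ← ∈-tabulate-prefix⁻ (F ∘ suc) as (∷-injectiveʳ eq) v∈ = suc i , s≤s lt , eq′

  ∈-tabulate-prefix⁺ : (F : Fin m → B) → ∀ as {bs} → tabulate F ≡ as ++ bs →
                       ∀ i → toℕ i < length as → F i ∈ as
  ∈-tabulate-prefix⁺ F (a ∷ as) eq zero    lt = here (∷-injectiveˡ eq)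
  ∈-tabulate-prefix⁺ F (a ∷ as) eq (suc i) lt =
    there (∈-tabulate-prefix⁺ (F ∘ suc) as (∷-injectiveʳ eq) i (s≤s⁻¹ lt))

  ∈-tabulate-suffix⁻ : (F : Fin m → B) → ∀ as {bs v} → tabulate F ≡ as ++ bs → v ∈ bs →
                       ∃ λ i → length as ≤ toℕ i × F i ≡ v
  ∈-tabulate-suffix⁻ F [] refl v∈ with i , eq ← ∈-tabulate⁻ v∈ = i , z≤n , sym eq
  ∈-tabulate-suffix⁻ {suc m} F (a ∷ as) eq v∈
    with i , le , eq′ ← ∈-tabulate-suffix⁻ (F ∘ suc) as (∷-injectiveʳ eq) v∈ = suc i , s≤s le , eq′

  ∈-tabulate-suffix⁺ : (F : Fin m → B) → ∀ as {bs} → tabulate F ≡ as ++ bs →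
                       ∀ i → length as ≤ toℕ i → F i ∈ bs
  ∈-tabulate-suffix⁺ F [] refl i le = ∈-tabulate⁺ i
  ∈-tabulate-suffix⁺ F (a ∷ as) eq (suc i) le =
    ∈-tabulate-suffix⁺ (F ∘ suc) as (∷-injectiveʳ eq) i (s≤s⁻¹ le)

  tabulate-unique⁻ : (F : Fin m → B) → Unique (tabulate F) → ∀ {i j} → F i ≡ F j → i ≡ j
  tabulate-unique⁻ F u {zero}  {zero}  eq = refl
  tabulate-unique⁻ F (F0∉ ∷ _) {zero}  {suc j} eq = ⊥-elim (All.lookup F0∉ (∈-tabulate⁺ j) eq)
  tabulate-unique⁻ F (F0∉ ∷ _) {suc i} {zero}  eq = ⊥-elim (All.lookup F0∉ (∈-tabulate⁺ i) (sym eq))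
  tabulate-unique⁻ F (_ ∷ u)   {suc i} {suc j} eq = cong suc (tabulate-unique⁻ (F ∘ suc) u eq)

  values : Vec (Fin n) m → List ℕ
  values π = tabulate (toℕ ∘ lookup π)

  values-injective : {π ρ : Vec (Fin n) m} → values π ≡ values ρ → π ≡ ρ
  values-injective {π = []}    {[]}    _  = refl
  values-injective {π = _ ∷ _} {_ ∷ _} eq =
    cong₂ _∷_ (Fin.toℕ-injective (∷-injectiveˡ eq)) (values-injective (∷-injectiveʳ eq))

  values-surjective : ∀ {L} → length L ≡ m → (∀ {v} → v ∈ L → v < n) →
                      ∃ λ (π : Vec (Fin n) m) → values π ≡ L
  values-surjective {L = []} refl _ = [] , refl
  values-surjective {L = v ∷ L} refl bounded
    with i , eq ← fromBound (bounded (here refl)) | π , eq′ ← values-surjective {L = L} refl (bounded ∘ there)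
    = i ∷ π , cong₂ _∷_ eq eq′

  permutation⇒arrangement : (π : Word n) → IsPermutation π → Arrangement n (values π)
  permutation⇒arrangement {n} π π! = record
    { unique = Unique.tabulate⁺ (VecUnique.lookup-injective π! _ _ ∘ Fin.toℕ-injective)
    ; bounded = λ v∈ → let i , eq = ∈-tabulate⁻ v∈ in subst (_< n) (sym eq) (Fin.toℕ<n _)
    ; full = λ v<n → full′ (fromBound v<n)
    ; size = length-tabulate _ }
    where
    full′ : ∀ {v} → (∃ λ (i : Fin n) → toℕ i ≡ v) → v ∈ values π
    full′ (i , refl) with Fin.any? (λ j → lookup π j Fin.≟ i)
    ... | yes (j , refl) = ∈-tabulate⁺ j
    -- Pigeonhole: a missing value put in front of `π` would give n + 1 distinct elements of
    -- `Fin n`.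
    ... | no  i∉ = ⊥-elim (1+n≰n (Fin.injective⇒≤ {f = lookup (i ∷ π)}
                     (VecUnique.lookup-injective i∷π! _ _)))
      where
      i∷π! : VecUnique.Unique (i ∷ π)
      i∷π! = subst (VecAll.All (λ k → i ≢ k)) (Vec.tabulate∘lookup π)
               (VecAll.tabulate⁺ (λ j i≡ → i∉ (j , sym i≡))) ∷ π!

  arrangement⇒permutation : (π : Word n) → Arrangement n (values π) → IsPermutation π
  arrangement⇒permutation π p = subst IsPermutation (Vec.tabulate∘lookup π)
    (VecUnique.tabulate⁺ (tabulate-unique⁻ _ (unique p) ∘ cong toℕ))

  module _ (π : Word n) {xs ys : List ℕ} (eq : values π ≡ xs ʳ++ ys) where
    private
      eq′ : values π ≡ reverse xs ++ ys
      eq′ = trans eq (ʳ++-defn xs)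

    length-split : length xs ≤ n
    length-split = ≤-trans (m≤m+n _ (length ys)) (≤-reflexive
      (trans (sym (length-ʳ++ xs)) (trans (cong length (sym eq)) (length-tabulate _))))

    module _ {j : Fin n} where
      -- Position `j` belongs both to its prefix and to its suffix, so the list before the cut has
      -- `suc (toℕ j)` values in the first case and `toℕ j` in the second.
      prefixSet⁻ : length xs ≡ suc (toℕ j) → ∀ {v} → toℕ v ∈ xs → prefixSet π j v
      prefixSet⁻ len v∈ with i , lt , F≡ ← ∈-tabulate-prefix⁻ _ (reverse xs) eq′ (Any.reverse⁺ v∈) =
        i , s≤s⁻¹ (≤-trans lt (≤-reflexive (trans (length-reverse xs) len))) , Fin.toℕ-injective F≡

      prefixSet⁺ : length xs ≡ suc (toℕ j) → ∀ {v} → prefixSet π j v → toℕ v ∈ xs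
      prefixSet⁺ len (i , i≤j , refl) = Any.reverse⁻ (∈-tabulate-prefix⁺ _ (reverse xs) eq′ i
        (≤-trans (s≤s i≤j) (≤-reflexive (sym (trans (length-reverse xs) len)))))

      suffixSet⁻ : length xs ≡ toℕ j → ∀ {v} → toℕ v ∈ ys → suffixSet π j v
      suffixSet⁻ len v∈ with i , le , F≡ ← ∈-tabulate-suffix⁻ _ (reverse xs) eq′ v∈ =
        i , ≤-trans (≤-reflexive (sym (trans (length-reverse xs) len))) le , Fin.toℕ-injective F≡

      suffixSet⁺ : length xs ≡ toℕ j → ∀ {v} → suffixSet π j v → toℕ v ∈ ys
      suffixSet⁺ len (i , j≤i , refl) = ∈-tabulate-suffix⁺ _ (reverse xs) eq′ i
        (≤-trans (≤-reflexive (trans (length-reverse xs) len)) j≤i)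

  split-at : (π : Word n) → ∀ k → k ≤ n → ∃₂ λ xs ys → values π ≡ xs ʳ++ ys × length xs ≡ k
  split-at π k k≤n = reverse (take k (values π)) , drop k (values π) ,
    (begin
      values π                                              ≡⟨ take++drop≡id k (values π) ⟨
      take k (values π) ++ drop k (values π)
        ≡⟨ cong (_++ drop k (values π)) (reverse-involutive (take k (values π))) ⟨
      reverse (reverse (take k (values π))) ++ drop k (values π) ≡⟨ ʳ++-defn (reverse (take k (values π))) ⟨
      reverse (take k (values π)) ʳ++ drop k (values π)     ∎) ,
    (begin
      length (reverse (take k (values π)))  ≡⟨ length-reverse (take k (values π)) ⟩
      length (take k (values π))            ≡⟨ length-take k (values π) ⟩
      k ⊓ length (values π)                 ≡⟨ cong (k ⊓_) (length-tabulate (toℕ ∘ lookup π)) ⟩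
      k ⊓ _                                 ≡⟨ m≤n⇒m⊓n≡m k≤n ⟩
      k                                     ∎)
    where open ≡-Reasoning

  -- Supplies the endpoints that the interval predicates ask for.
  hull : ∀ z zs → ∃₂ λ lo hi → lo ∈ z ∷ zs × hi ∈ z ∷ zs × (∀ {v} → v ∈ z ∷ zs → lo ≤ v × v ≤ hi)
  hull z [] = z , z , here refl , here refl , λ { (here refl) → ≤-refl , ≤-refl }
  hull z (y ∷ ys) with lo , hi , lo∈ , hi∈ , bounds ← hull y ys with ≤-total z lo | ≤-total z hi
  ... | inj₁ z≤lo | inj₁ z≤hi = z , hi , here refl , there hi∈ , λ where
    (here refl) → ≤-refl , z≤hi
    (there v∈)  → ≤-trans z≤lo (proj₁ (bounds v∈)) , proj₂ (bounds v∈)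
  ... | inj₁ z≤lo | inj₂ hi≤z = z , z , here refl , here refl , λ where
    (here refl) → ≤-refl , ≤-refl
    (there v∈)  → ≤-trans z≤lo (proj₁ (bounds v∈)) , ≤-trans (proj₂ (bounds v∈)) hi≤z
  ... | inj₂ lo≤z | inj₁ z≤hi = lo , hi , there lo∈ , there hi∈ , λ where
    (here refl) → lo≤z , z≤hi
    (there v∈)  → bounds v∈
  ... | inj₂ lo≤z | inj₂ hi≤z = lo , z , there lo∈ , here refl , λ where
    (here refl) → lo≤z , ≤-refl
    (there v∈)  → proj₁ (bounds v∈) , ≤-trans (proj₂ (bounds v∈)) hi≤z

  module _ {S : Pred (Fin n) 0ℓ} {xs : List ℕ}
           (S⁻ : ∀ {v} → toℕ v ∈ xs → S v) (S⁺ : ∀ {v} → S v → toℕ v ∈ xs) where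

    interval⇒convex : (∀ {v} → v ∈ xs → v < n) → IsIntervalℤ S → Convex xs
    interval⇒convex bound (lo , hi , _ , S⇒ , ⇒S) a∈ c∈ a≤b b≤c
      with a , refl ← fromBound (bound a∈) | c , refl ← fromBound (bound c∈)
         | b , refl ← fromBound (≤-<-trans b≤c (bound c∈))
      = S⁺ (⇒S (≤-trans (proj₁ (S⇒ (S⁻ a∈))) a≤b , ≤-trans b≤c (proj₂ (S⇒ (S⁻ c∈)))))

    convex⇒interval : (∀ {v} → v ∈ xs → v < n) → ∀ {z zs} → xs ≡ z ∷ zs → Convex xs → IsIntervalℤ S
    convex⇒interval bound {z} {zs} refl convex with hull z zs
    ... | lo , hi , lo∈ , hi∈ , bounds
      with a , refl ← fromBound (bound lo∈) | b , refl ← fromBound (bound hi∈)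
      = a , b , proj₁ (bounds hi∈) , bounds ∘ S⁺ , λ (a≤v , v≤b) → S⁻ (convex lo∈ hi∈ a≤v v≤b)

    module _ {ys : List ℕ} (P : Partition n xs ys) where

      cyclicInterval⇒convex : IsIntervalℤₙ S → Convex xs ⊎ Convex ys
      cyclicInterval⇒convex (lo , hi , lo≤hi , inj₁ S≐) =
        inj₁ (interval⇒convex (boundˡ P) (lo , hi , lo≤hi , S≐))
      cyclicInterval⇒convex (lo , hi , lo≤hi , inj₂ (S⇒ , ⇒S)) = inj₂ λ a∈ c∈ a≤b b≤c →
        between (cover P (≤-<-trans b≤c (boundʳ P c∈))) a∈ c∈ a≤b b≤c
        where
        between : ∀ {a b c} → b ∈ xs ⊎ b ∈ ys → a ∈ ys → c ∈ ys → a ≤ b → b ≤ c → b ∈ ys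
        between (inj₂ b∈) _ _ _ _ = b∈
        between (inj₁ b∈) a∈ c∈ a≤b b≤c
          with a , refl ← fromBound (boundʳ P a∈) | c , refl ← fromBound (boundʳ P c∈)
             | b , refl ← fromBound (boundˡ P b∈)
          with S⇒ (S⁻ b∈)
        ... | inj₁ hi≤b = ⊥-elim (disjoint P (S⁺ (⇒S (inj₁ (≤-trans hi≤b b≤c)))) c∈)
        ... | inj₂ b≤lo = ⊥-elim (disjoint P (S⁺ (⇒S (inj₂ (≤-trans a≤b b≤lo)))) a∈)

      private
        convexˡ : ∀ {z zs} → xs ≡ z ∷ zs → Convex xs → IsIntervalℤₙ S
        convexˡ eq convex with lo , hi , lo≤hi , S≐ ← convex⇒interval (boundˡ P) eq convex =
          lo , hi , lo≤hi , inj₁ S≐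

      -- If the convex complement `ys` touches neither end, `xs` wraps around it, with endpoints one
      -- below its minimum and one above its maximum. If `ys` is empty or touches an end, one of
      -- these endpoints does not exist, but then `xs` is itself convex.
      convex⇒cyclicInterval : ∀ {z zs} → xs ≡ z ∷ zs → Convex xs ⊎ Convex ys → IsIntervalℤₙ S
      convex⇒cyclicInterval eq (inj₁ convex) = convexˡ eq convex
      convex⇒cyclicInterval eq (inj₂ convex) = go _ refl
        where
        go : ∀ zs → ys ≡ zs → IsIntervalℤₙ S
        go [] refl = convexˡ eq λ _ c∈ _ b≤c →
          [ (λ b∈ → b∈) , (λ ()) ]′ (cover P (≤-<-trans b≤c (boundˡ P c∈)))
        go (y ∷ ys′) refl with hull y ys′
        ... | zero , _ , lo∈ , _ =
          convexˡ eq (convex-complement (partition-sym P) (inj₁ refl) lo∈ convex)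
        ... | suc l , hi , lo∈ , hi∈ , bounds with m≤n⇒m<n∨m≡n (boundʳ P hi∈)
        ... | inj₂ hi≡ = convexˡ eq (convex-complement (partition-sym P) (inj₂ hi≡) hi∈ convex)
        ... | inj₁ 1+hi<n
          with a , a≡ ← fromBound (<-trans (n<1+n l) (boundʳ P lo∈)) | b , b≡ ← fromBound 1+hi<n
          = a , b ,
            subst₂ _≤_ (sym a≡) (sym b≡) (≤-trans (n≤1+n l) (≤-trans (proj₁ (bounds hi∈)) (n≤1+n hi))) ,
            inj₂ (outside , inside)
          where
          outside : ∀ {v} → S v → wrap a b v
          outside {v} Sv with ≤-<-connex (toℕ v) l | <-≤-connex hi (toℕ v)
          ... | inj₁ v≤l | _         = inj₂ (subst (toℕ v ≤_) (sym a≡) v≤l)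
          ... | inj₂ _   | inj₁ hi<v = inj₁ (subst (_≤ toℕ v) (sym b≡) hi<v)
          ... | inj₂ l<v | inj₂ v≤hi = ⊥-elim (disjoint P (S⁺ Sv) (convex lo∈ hi∈ l<v v≤hi))
          inside : ∀ {v} → wrap a b v → S v
          inside {v} w with cover P (Fin.toℕ<n v) | w
          ... | inj₁ v∈ | _ = S⁻ v∈
          ... | inj₂ v∈ | inj₁ b≤v = ⊥-elim (<⇒≱ (subst (_≤ toℕ v) b≡ b≤v) (proj₂ (bounds v∈)))
          ... | inj₂ v∈ | inj₂ v≤a = ⊥-elim (<⇒≱ (s≤s (subst (toℕ v ≤_) a≡ v≤a)) (proj₁ (bounds v∈)))

  module _ (π : Word n) (p : Arrangement n (values π)) where
    private
      nonempty : ∀ {zs : List ℕ} {k} → length zs ≡ suc k → ∃₂ λ z zs′ → zs ≡ z ∷ zs′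
      nonempty {z ∷ zs} _ = z , zs , refl

      parts : ∀ xs {ys} → values π ≡ xs ʳ++ ys → Partition n xs ys
      parts xs = arrangement-partition p xs _

    isArc⇒arc : IsArc π → Arc (values π)
    isArc⇒arc arc [] ys eq = inj₁ λ ()
    isArc⇒arc arc (x ∷ xs) ys eq with j , j≡ ← fromBound (length-split π {x ∷ xs} eq) =
      cyclicInterval⇒convex (prefixSet⁻ π eq len) (prefixSet⁺ π eq len) (parts (x ∷ xs) eq) (arc j)
      where len = cong suc (sym j≡)

    arc⇒isArc : Arc (values π) → IsArc π
    arc⇒isArc arc j with xs , ys , eq , len ← split-at π (suc (toℕ j)) (Fin.toℕ<n j)
      with _ , _ , xs≡ ← nonempty {xs} len =
      convex⇒cyclicInterval (prefixSet⁻ π eq len) (prefixSet⁺ π eq len) (parts xs eq) xs≡ (arc xs ys eq)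

    prefixes⇒prefixConvex : (∀ j → IsIntervalℤ (prefixSet π j)) → PrefixConvex (values π)
    prefixes⇒prefixConvex intervals [] ys eq = λ ()
    prefixes⇒prefixConvex intervals (x ∷ xs) ys eq with j , j≡ ← fromBound (length-split π {x ∷ xs} eq) =
      interval⇒convex (prefixSet⁻ π eq len) (prefixSet⁺ π eq len) (boundˡ (parts (x ∷ xs) eq)) (intervals j)
      where len = cong suc (sym j≡)

    prefixConvex⇒prefixes : PrefixConvex (values π) → ∀ j → IsIntervalℤ (prefixSet π j)
    prefixConvex⇒prefixes convex j with xs , ys , eq , len ← split-at π (suc (toℕ j)) (Fin.toℕ<n j)
      with _ , _ , xs≡ ← nonempty {xs} len =
      convex⇒interval (prefixSet⁻ π eq len) (prefixSet⁺ π eq len) (boundˡ (parts xs eq)) xs≡ (convex xs ys eq)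

    suffixes⇒suffixConvex : (∀ j → IsIntervalℤ (suffixSet π j)) → SuffixConvex (values π)
    suffixes⇒suffixConvex intervals xs ys eq with m≤n⇒m<n∨m≡n (length-split π {xs} eq)
    ... | inj₁ lt with j , j≡ ← fromBound lt =
      interval⇒convex (suffixSet⁻ π {xs} eq (sym j≡)) (suffixSet⁺ π {xs} eq (sym j≡))
        (boundʳ (parts xs eq)) (intervals j)
    ... | inj₂ len with ys
    ... | [] = λ ()
    ... | y ∷ ys′ = ⊥-elim (m+1+n≢m (length xs) (trans (sym (length-ʳ++ xs))
      (trans (cong length (sym eq)) (trans (size p) (sym len)))))

    suffixConvex⇒suffixes : SuffixConvex (values π) → ∀ j → IsIntervalℤ (suffixSet π j)
    suffixConvex⇒suffixes convex j with xs , ys , eq , len ← split-at π (toℕ j) (<⇒≤ (Fin.toℕ<n j)) =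
      convex⇒interval (suffixSet⁻ π {xs} eq len) (suffixSet⁺ π {xs} eq len) (boundʳ (parts xs eq))
        (proj₂ (proj₂ (ys≡ ys eq))) (convex xs ys eq)
      where
      ys≡ : ∀ ys → values π ≡ xs ʳ++ ys → ∃₂ λ z zs → ys ≡ z ∷ zs
      ys≡ (y ∷ ys) _ = y , ys , refl
      ys≡ [] eq = ⊥-elim (<-irrefl (trans (sym len) (trans (sym (+-identityʳ _))
        (trans (sym (length-ʳ++ xs)) (trans (cong length (sym eq)) (size p))))) (Fin.toℕ<n j))

  descent⇒At : (π : Word n) (i : Fin n) → IsDescent π i → At (consecutive _>ᵇ_ (values π)) (toℕ i)
  descent⇒At π i (j , j≡ , lt) =
    At-consecutive⁺ _>ᵇ_ (toℕ ∘ lookup π) j≡ (>ᵇ-desc lt)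

  At⇒descent : (π : Word n) (i : Fin n) → At (consecutive _>ᵇ_ (values π)) (toℕ i) → IsDescent π i
  At⇒descent π i at with j , j≡ , gt ← At-consecutive⁻ _>ᵇ_ (toℕ ∘ lookup π) i at =
    j , j≡ , >ᵇ⇒> gt
    where
    >ᵇ⇒> : ∀ {a b} → a >ᵇ b ≡ true → b < a
    >ᵇ⇒> {a} {b} eq = <ᵇ⇒< b a (subst Bool.T (sym eq) _)

-- Standard tableaux of near-hook shape, encoded by cell types.

module NearHooks where

  open import Data.Fin using (_≤_; _<_)

  Sorted : List (Fin n) → Set
  Sorted = AllPairs _<_

  sorted-head : ∀ {x y : Fin n} {xs} → Sorted (x ∷ xs) → y ∈ x ∷ xs → x ≤ y
  sorted-head _          (here refl) = ℕ.≤-refl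
  sorted-head (x< ∷ _)   (there y∈)  = ℕ.<⇒≤ (All.lookup x< y∈)

  sorted⇒unique : ∀ {xs : List (Fin n)} → Sorted xs → Unique xs
  sorted⇒unique = AllPairs.map Fin.<⇒≢

  -- Rows and columns increase, so they are determined by their sets of entries; this is how a
  -- tableau and its cell types determine each other.
  sorted-≡ : ∀ {xs ys : List (Fin n)} → Sorted xs → Sorted ys →
             (∀ {i} → i ∈ xs → i ∈ ys) → (∀ {i} → i ∈ ys → i ∈ xs) → xs ≡ ys
  sorted-≡ {xs = []}     {[]}     _ _ _ _ = refl
  sorted-≡ {xs = []}     {y ∷ ys} _ _ _ ⊇ with () ← ⊇ (here refl)
  sorted-≡ {xs = x ∷ xs} {[]}     _ _ ⊆ _ with () ← ⊆ (here refl)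
  sorted-≡ {xs = x ∷ xs} {y ∷ ys} s@(x< ∷ xs↗) s′@(y< ∷ ys↗) ⊆ ⊇
    with refl ← Fin.≤-antisym (sorted-head s (⊇ (here refl))) (sorted-head s′ (⊆ (here refl)))
    = cong (x ∷_) (sorted-≡ xs↗ ys↗ (below x< ⊆) (below y< ⊇))
    where
    below : ∀ {zs ws} → All (x <_) zs → (∀ {i} → i ∈ x ∷ zs → i ∈ x ∷ ws) → ∀ {i} → i ∈ zs → i ∈ ws
    below x<zs sub i∈ with sub (there i∈)
    ... | here refl = ⊥-elim (Fin.<-irrefl refl (All.lookup x<zs i∈))
    ... | there i∈′ = i∈′

  allFin-sorted : ∀ n → Sorted (allFin n)
  allFin-sorted n = AllPairs.tabulate⁺-< (λ i<j → i<j)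

  -- A standard filling of shape (k, 2, 1, …, 1) is encoded by the type of cell
  -- each entry lies in: the first row, the rest of the first column, or (2,2).
  data Cell : Set where
    arm leg inner : Cell

  _≟ᶜ_ : (κ κ′ : Cell) → Dec (κ ≡ κ′)
  arm   ≟ᶜ arm   = yes refl
  arm   ≟ᶜ leg   = no λ ()
  arm   ≟ᶜ inner = no λ ()
  leg   ≟ᶜ arm   = no λ ()
  leg   ≟ᶜ leg   = yes refl
  leg   ≟ᶜ inner = no λ ()
  inner ≟ᶜ arm   = no λ ()
  inner ≟ᶜ leg   = no λ ()
  inner ≟ᶜ inner = yes refl

  entries : Cell → (Fin n → Cell) → List (Fin n)
  entries κ F = filter (λ i → F i ≟ᶜ κ) (allFin _)

  module _ {F : Fin n → Cell} where

    entries-sorted : ∀ κ → Sorted (entries κ F)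
    entries-sorted κ = AllPairs.filter⁺ _ (allFin-sorted n)

    ∈-entries⁺ : ∀ {κ i} → F i ≡ κ → i ∈ entries κ F
    ∈-entries⁺ = ∈-filter⁺ _ (∈-allFin _)

    ∈-entries⁻ : ∀ {κ i} → i ∈ entries κ F → F i ≡ κ
    ∈-entries⁻ = proj₂ ∘ ∈-filter⁻ _ {xs = allFin n}

    entries-≡ : ∀ {κ xs} → Sorted xs → (∀ {i} → i ∈ xs → F i ≡ κ) → (∀ {i} → F i ≡ κ → i ∈ xs) →
                entries κ F ≡ xs
    entries-≡ xs↗ sound complete =
      sorted-≡ (entries-sorted _) xs↗ (complete ∘ ∈-entries⁻) (∈-entries⁺ ∘ sound)

  -- Near-hook fillings and membership in `𝒯`.

  nearHook : List (Fin n) → Fin n → Fin n → List (Fin n) → Filling n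
  nearHook arms c d cs = arms ∷ (c ∷ d ∷ []) ∷ map [_] cs

  concat-nearHook : ∀ arms (c d : Fin n) cs → concat (nearHook arms c d cs) ≡ arms ++ c ∷ d ∷ cs
  concat-nearHook arms c d cs = cong (λ zs → arms ++ c ∷ d ∷ zs) (concat-map-[_] cs)

  -- Against a row of length one only `c` is compared, since `zip` truncates; `d` imposes no
  -- condition downwards.
  column⁺ : ∀ {c d : Fin n} cs → Linked _<_ (c ∷ cs) → Linked _Above_ ((c ∷ d ∷ []) ∷ map [_] cs)
  column⁺ []        _ = [-]
  column⁺ {n} (c′ ∷ cs) (c<c′ ∷ cs↗) = (c<c′ ∷ []) ∷ singles cs cs↗
    where
    singles : ∀ {c : Fin n} cs → Linked _<_ (c ∷ cs) → Linked _Above_ (map [_] (c ∷ cs))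
    singles []       _          = [-]
    singles (_ ∷ cs) (lt ∷ cs↗) = (lt ∷ []) ∷ singles cs cs↗

  column⁻ : ∀ {c d : Fin n} cs → Linked _Above_ ((c ∷ d ∷ []) ∷ map [_] cs) → Linked _<_ (c ∷ cs)
  column⁻ []        _ = [-]
  column⁻ {n} (c′ ∷ cs) ((c<c′ ∷ []) ∷ rows) = c<c′ ∷ singles cs rows
    where
    singles : ∀ {c : Fin n} cs → Linked _Above_ (map [_] (c ∷ cs)) → Linked _<_ (c ∷ cs)
    singles []       _                   = [-]
    singles (_ ∷ cs) ((lt ∷ []) ∷ rows) = lt ∷ singles cs rows

  ∈-fillings⁺ : ∀ (T : Filling n) → T ∈ fillings n (map length T)
  ∈-fillings⁺ [] = here refl
  ∈-fillings⁺ {n} (r ∷ T) = ∈-cartesianProductWith⁺ _∷_ row (∈-fillings⁺ T)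
    where
    row : r ∈ map Vec.toList (allVecs (allFin n) (length r))
    row = subst (_∈ map Vec.toList (allVecs (allFin n) (length r)))
      (Vec.toList∘fromList r) (∈-map⁺ Vec.toList (∈-allVecs (Vec.fromList r)))

  ∈-fillings⁻ : ∀ ls {T : Filling n} → T ∈ fillings n ls → map length T ≡ ls
  ∈-fillings⁻ [] (here refl) = refl
  ∈-fillings⁻ {n} (l ∷ ls) T∈
    with r , T′ , r∈ , T′∈ , refl ←
           ∈-cartesianProductWith⁻ _∷_ (map Vec.toList (allVecs (allFin n) l)) (fillings n ls) T∈
    with v , _ , refl ← ∈-map⁻ Vec.toList r∈
    = cong₂ _∷_ (Vec.length-toList v) (∈-fillings⁻ ls T′∈)

  shape : ℕ → ℕ → List ℕ
  shape n k = k ∷ 2 ∷ replicate (n ∸ k ∸ 2) 1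

  ∈-𝒯⁺ : ∀ {k} {T : Filling n} → 2 ℕ.≤ k → k ℕ.≤ n ∸ 2 → k ℕ.< n →
          map length T ≡ shape n k → IsStandard T → T ∈ 𝒯 n
  ∈-𝒯⁺ {n} {k} {T} 2≤k k≤ k<n len standard =
    ∈-concatMap⁺ (λ k → SYT n (shape n k)) (Any.map (λ { refl → T∈ }) (∈-filter⁺ _ (∈-upTo⁺ k<n) (2≤k , k≤)))
    where
    T∈ : T ∈ SYT n (shape n k)
    T∈ = ∈-filter⁺ isStandard? (subst (λ ls → T ∈ fillings n ls) len (∈-fillings⁺ T)) standard

  ∈-𝒯⁻ : ∀ {T : Filling n} → T ∈ 𝒯 n →
          ∃ λ k → 2 ℕ.≤ k × map length T ≡ shape n k × IsStandard T
  ∈-𝒯⁻ {n} T∈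
    with k , k∈ , T∈′ ← find (∈-concatMap⁻ (λ k → SYT n (shape n k)) T∈)
    with T∈f , standard ← ∈-filter⁻ isStandard? {xs = fillings n (shape n k)} T∈′
    = k , proj₁ (proj₂ (∈-filter⁻ _ {xs = upTo n} k∈)) , ∈-fillings⁻ (shape n k) T∈f , standard

  -- The entries `a`, `a′`, `c`, `d` occupy the cells (1,1), (1,2), (2,1), (2,2).
  record IsNearHook (arms : List (Fin n)) (c d : Fin n) (cs : List (Fin n)) : Set where
    field
      {a a′}      : Fin n
      {as}        : List (Fin n)
      arms≡       : arms ≡ a ∷ a′ ∷ as
      arms-sorted : Sorted arms
      legs-sorted : Sorted (c ∷ cs)
      a<c         : a < c
      a′<d        : a′ < d
      c<d         : c < d
      nonrepeating : Unique (arms ++ c ∷ d ∷ cs)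
      complete    : ∀ i → i ∈ arms ++ c ∷ d ∷ cs

  nearHook-standard⁺ : ∀ {arms c d} {cs : List (Fin n)} → IsNearHook arms c d cs →
                       IsStandard (nearHook arms c d cs)
  nearHook-standard⁺ {arms = arms} {c} {d} {cs} record
    { arms≡ = refl ; arms-sorted = arms↗ ; legs-sorted = legs↗ ; a<c = a<c ; a′<d = a′<d ; c<d = c<d
    ; nonrepeating = unique ; complete = complete } =
    (subst Unique (sym (concat-nearHook arms c d cs)) unique ,
     λ i → subst (i ∈_) (sym (concat-nearHook arms c d cs)) (complete i)) ,
    Linked.AllPairs⇒Linked arms↗ ∷ (c<d ∷ [-]) ∷ All.map⁺ (All.universal (λ _ → [-]) cs) ,
    above _ a<c a′<d ∷ column⁺ cs (Linked.AllPairs⇒Linked legs↗)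
    where
    above : ∀ {a a′ c d : Fin _} as → a < c → a′ < d → (a ∷ a′ ∷ as) Above (c ∷ d ∷ [])
    above []       lt lt′ = lt ∷ lt′ ∷ []
    above (_ ∷ as) lt lt′ = lt ∷ lt′ ∷ []

  nearHook-standard⁻ : ∀ {a a′ as c d} {cs : List (Fin n)} → IsStandard (nearHook (a ∷ a′ ∷ as) c d cs) →
                       IsNearHook (a ∷ a′ ∷ as) c d cs
  nearHook-standard⁻ {a = a} {a′} {as} {c} {d} {cs}
    ((unique , complete) , arms↗ ∷ (c<d ∷ [-]) ∷ _ , (a<c ∷ a′<d ∷ _) ∷ column) = record
    { arms≡ = refl
    ; arms-sorted = Linked.Linked⇒AllPairs Fin.<-trans arms↗
    ; legs-sorted = Linked.Linked⇒AllPairs Fin.<-trans (column⁻ cs column)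
    ; a<c = a<c ; a′<d = a′<d ; c<d = c<d
    ; nonrepeating = subst Unique (concat-nearHook (a ∷ a′ ∷ as) c d cs) unique
    ; complete = λ i → subst (i ∈_) (concat-nearHook (a ∷ a′ ∷ as) c d cs) (complete i) }

  private
    singleton-rows : ∀ k {T : Filling n} → map length T ≡ replicate k 1 → ∃ λ cs → T ≡ map [_] cs
    singleton-rows zero {[]} _ = [] , refl
    singleton-rows (suc k) {(c ∷ []) ∷ T} eq
      with cs , refl ← singleton-rows k {T} (∷-injectiveʳ eq) = c ∷ cs , refl

    nearHook-shape : ∀ {k l} {T : Filling n} → 2 ℕ.≤ k → map length T ≡ k ∷ 2 ∷ replicate l 1 →
      ∃₂ λ a a′ → ∃₂ λ as c → ∃₂ λ d cs → T ≡ nearHook (a ∷ a′ ∷ as) c d cs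
    nearHook-shape {l = l} {T = (a ∷ a′ ∷ as) ∷ (c ∷ d ∷ []) ∷ T} _ eq
      with cs , refl ← singleton-rows l {T} (∷-injectiveʳ (∷-injectiveʳ eq)) = _ , _ , _ , _ , _ , _ , refl
    nearHook-shape {T = [] ∷ _} 2≤k eq with refl ← ∷-injectiveˡ eq with () ← 2≤k
    nearHook-shape {T = (_ ∷ []) ∷ _} 2≤k eq with refl ← ∷-injectiveˡ eq with s≤s () ← 2≤k

  ∈-𝒯⇒nearHook : ∀ {T : Filling n} → T ∈ 𝒯 n →
    ∃₂ λ arms c → ∃₂ λ d cs → T ≡ nearHook arms c d cs × IsNearHook arms c d cs
  ∈-𝒯⇒nearHook T∈ with k , 2≤k , len , standard ← ∈-𝒯⁻ T∈
    with _ , _ , _ , _ , _ , _ , refl ← nearHook-shape 2≤k len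
    = _ , _ , _ , _ , refl , nearHook-standard⁻ standard

  -- The shapes in `𝒯` express the column length through n and k, so it has to be counted: every
  -- entry occurs exactly once, hence n is the total number of cells.
  nearHook⇒∈-𝒯 : ∀ {arms c d} {cs : List (Fin n)} → IsNearHook arms c d cs → nearHook arms c d cs ∈ 𝒯 n
  nearHook⇒∈-𝒯 {n} {arms} {c} {d} {cs} H = ∈-𝒯⁺ 2≤k k≤ k<n shape≡ (nearHook-standard⁺ H)
    where
    open IsNearHook H
    k = length arms
    l = length cs
    n≡ : n ≡ k + (2 + l)
    n≡ = begin
      n                              ≡⟨ length-tabulate id ⟨
      length (allFin n)              ≡⟨ Permutation.↭-length (∼bag⇒↭ (unique∧set⇒bag (Unique.allFin⁺ n)
                                          nonrepeating (mk⇔ (λ _ → complete _) (λ _ → ∈-allFin _)))) ⟩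
      length (arms ++ c ∷ d ∷ cs)    ≡⟨ length-++ arms ⟩
      k + (2 + l)                    ∎
      where open ≡-Reasoning
    2≤k : 2 ℕ.≤ k
    2≤k = subst (λ zs → 2 ℕ.≤ length zs) (sym arms≡) (s≤s (s≤s z≤n))
    k≤ : k ℕ.≤ n ∸ 2
    k≤ = ℕ.≤-trans (ℕ.m≤m+n k l) (ℕ.≤-reflexive (begin
      k + l                ≡⟨ ℕ.m+n∸n≡m (k + l) 2 ⟨
      k + l + 2 ∸ 2        ≡⟨ cong (_∸ 2) (trans (ℕ.+-assoc k l 2) (cong (k +_) (ℕ.+-comm l 2))) ⟩
      k + (2 + l) ∸ 2      ≡⟨ cong (_∸ 2) n≡ ⟨
      n ∸ 2                ∎))
      where open ≡-Reasoning
    k<n : k ℕ.< n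
    k<n = ℕ.≤-trans (ℕ.m<m+n k (s≤s z≤n)) (ℕ.≤-reflexive (sym n≡))
    rows : ∀ zs → map length (map [_] zs) ≡ replicate (length zs) 1
    rows []       = refl
    rows (z ∷ zs) = cong (1 ∷_) (rows zs)
    shape≡ : map length (nearHook arms c d cs) ≡ shape n k
    shape≡ = cong (λ zs → k ∷ 2 ∷ zs) (trans (rows cs) (cong (λ j → replicate j 1) (begin
      l                      ≡⟨ cong (_∸ 2) (ℕ.m+n∸m≡n k (2 + l)) ⟨
      k + (2 + l) ∸ k ∸ 2    ≡⟨ cong (λ j → j ∸ k ∸ 2) n≡ ⟨
      n ∸ k ∸ 2              ∎)))
      where open ≡-Reasoning

  𝒯-unique : ∀ n → Unique (𝒯 n)
  𝒯-unique n = Unique.concat⁺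
    (All.map⁺ (All.universal (λ k → Unique.filter⁺ isStandard? (fillings-unique (shape n k))) _))
    (AllPairs.map⁺ {f = λ k → SYT n (shape n k)}
      (AllPairs.map (λ {k} {k′} → disjoint {k} {k′}) (Unique.filter⁺ _ (Unique.upTo⁺ n))))
    where
    lengths : ∀ {k T} → T ∈ SYT n (shape n k) → map length T ≡ shape n k
    lengths {k} T∈ = ∈-fillings⁻ (shape n k)
      (proj₁ (∈-filter⁻ isStandard? {xs = fillings n (shape n k)} T∈))
    disjoint : ∀ {k k′} → k ≢ k′ → Disjoint (SYT n (shape n k)) (SYT n (shape n k′))
    disjoint k≢k′ (T∈ , T∈′) = k≢k′ (∷-injectiveˡ (trans (sym (lengths T∈)) (lengths T∈′)))
    fillings-unique : ∀ ls → Unique (fillings n ls)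
    fillings-unique []       = [] ∷ []
    fillings-unique (l ∷ ls) = Unique.cartesianProductWith⁺ _∷_ (λ eq → ∷-injective eq)
      (Unique.map⁺ (λ {v w} eq → trans (sym (Vec.cast-is-id refl v)) (Vec.toList-injective refl v w eq))
        (allVecs-unique (Unique.allFin⁺ n) l))
      (fillings-unique ls)

  -- The word of cell types of a tableau.

  record Split (F : Fin n → A) (d : Fin n) (as bs : List A) : Set where
    field
      before⁺ : ∀ {i} → i < d → F i ∈ as
      before⁻ : ∀ {v} → v ∈ as → ∃ λ i → i < d × F i ≡ v
      after⁺  : ∀ {i} → d < i → F i ∈ bs
      after⁻  : ∀ {v} → v ∈ bs → ∃ λ i → d < i × F i ≡ v

  split-zero : (F : Fin (suc n) → A) → Split F zero [] (tabulate (F ∘ suc))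
  split-zero F = record
    { before⁺ = λ () ; before⁻ = λ ()
    ; after⁺ = λ { {suc i} _ → ∈-tabulate⁺ i }
    ; after⁻ = λ v∈ → let i , eq = ∈-tabulate⁻ v∈ in suc i , s≤s z≤n , sym eq }

  split-suc : (F : Fin (suc n) → A) {d : Fin n} {as bs : List A} →
              Split (F ∘ suc) d as bs → Split F (suc d) (F zero ∷ as) bs
  split-suc F S = record
    { before⁺ = λ { {zero} _ → here refl ; {suc i} (s≤s lt) → there (before⁺ lt) }
    ; before⁻ = λ { (here refl) → zero , s≤s z≤n , refl
                  ; (there v∈) → let i , lt , eq = before⁻ v∈ in suc i , s≤s lt , eq }
    ; after⁺ = λ { {suc i} (s≤s lt) → after⁺ lt }
    ; after⁻ = λ v∈ → let i , lt , eq = after⁻ v∈ in suc i , s≤s lt , eq }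
    where open Split S

  split-at-index : (F : Fin n → A) (d : Fin n) →
                   ∃₂ λ as bs → tabulate F ≡ as ++ F d ∷ bs × Split F d as bs
  split-at-index F zero    = [] , _ , refl , split-zero F
  split-at-index F (suc d) with as , bs , eq , S ← split-at-index (F ∘ suc) d =
    F zero ∷ as , bs , cong (F zero ∷_) eq , split-suc F S

  index-of-split : (F : Fin n → A) {x : A} {bs : List A} → ∀ as → tabulate F ≡ as ++ x ∷ bs →
                   ∃ λ d → F d ≡ x × Split F d as bs
  index-of-split {suc n} F []       refl = zero , refl , split-zero F
  index-of-split {suc n} F (a ∷ as) eq
    with d , eq′ , S ← index-of-split (F ∘ suc) as (∷-injectiveʳ eq) with refl ← ∷-injectiveˡ eq
    = suc d , eq′ , split-suc F S

  ι : Bool → Cell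
  ι false = arm
  ι true  = leg

  ι-injective : ∀ {a b} → ι a ≡ ι b → a ≡ b
  ι-injective {false} {false} _ = refl
  ι-injective {true}  {true}  _ = refl

  ι≢inner : ∀ {b} → ι b ≢ inner
  ι≢inner {false} ()
  ι≢inner {true}  ()

  -- The cells of the entries in increasing order; p is the part before the entry
  -- of cell (2,2), reversed.
  word : List Bool → List Bool → List Cell
  word p v = arm ∷ (map ι p ʳ++ (inner ∷ map ι v))

  -- The inequality `c < d` is kept because the descent from `inner` to `leg` rests on it.
  IsTableau : (Fin n → Cell) → Filling n → Set
  IsTableau F T = ∃₂ λ c d → ∃ λ cs → T ≡ nearHook (entries arm F) c d cs
    × entries leg F ≡ c ∷ cs × entries inner F ≡ d ∷ [] × c < d

  Encodes : List Bool → List Bool → Filling n → Set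
  Encodes {n} p v T = ∃ λ (F : Fin n → Cell) → tabulate F ≡ word p v × IsTableau F T

  unique-++-disjoint : ∀ (xs : List A) {ys v} → Unique (xs ++ ys) → v ∈ xs → v ∉ ys
  unique-++-disjoint (x ∷ xs) (x∉ ∷ _) (here refl) v∈ = All.lookup x∉ (∈-++⁺ʳ xs v∈) refl
  unique-++-disjoint (x ∷ xs) (_ ∷ u)  (there v∈)  v∈′ = unique-++-disjoint xs u v∈ v∈′

  unique-++⁻ʳ : ∀ (xs : List A) {ys} → Unique (xs ++ ys) → Unique ys
  unique-++⁻ʳ []       u       = u
  unique-++⁻ʳ (_ ∷ xs) (_ ∷ u) = unique-++⁻ʳ xs u

  word-split : ∀ q v → arm ∷ map ι q ++ inner ∷ map ι v ≡ word (reverse q) v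
  word-split q v = cong (arm ∷_) (sym (begin
    map ι (reverse q) ʳ++ X            ≡⟨ ʳ++-defn (map ι (reverse q)) ⟩
    reverse (map ι (reverse q)) ++ X   ≡⟨ cong (λ w → reverse w ++ X) (reverse-map ι q) ⟩
    reverse (reverse (map ι q)) ++ X   ≡⟨ cong (_++ X) (reverse-involutive (map ι q)) ⟩
    map ι q ++ X                       ∎))
    where
    open ≡-Reasoning
    X = inner ∷ map ι v

  without-inner : ∀ κs → inner ∉ κs → ∃ λ q → κs ≡ map ι q
  without-inner []           _  = [] , refl
  without-inner (arm ∷ κs)   ∉κs with q , refl ← without-inner κs (∉κs ∘ there) = false ∷ q , refl
  without-inner (leg ∷ κs)   ∉κs with q , refl ← without-inner κs (∉κs ∘ there) = true ∷ q , refl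
  without-inner (inner ∷ κs) ∉κs = ⊥-elim (∉κs (here refl))

  ι∈⇒∈ : ∀ {b} q → ι b ∈ map ι q → b ∈ q
  ι∈⇒∈ q ι∈ with b′ , b′∈ , eq ← ∈-map⁻ ι ι∈ = subst (_∈ q) (sym (ι-injective eq)) b′∈

  arm≢leg : arm ≢ leg
  arm≢leg ()

  arm≢inner : arm ≢ inner
  arm≢inner ()

  leg≢inner : leg ≢ inner
  leg≢inner ()

  -- The entries `a′` of (1,2) and `c` of (2,1) precede `d`, and neither is the least entry; they
  -- provide the letters `false` and `true` of `p`.
  cells⇒word : (F : Fin n → Cell) {a a′ c d : Fin n} → (∀ (i : Fin n) → a ≤ i) → a < a′ → a′ < d → c < d →
    F a ≡ arm → F a′ ≡ arm → F c ≡ leg → F d ≡ inner → (∀ {i} → F i ≡ inner → i ≡ d) →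
    ∃₂ λ p v → tabulate F ≡ word p v × false ∈ p × true ∈ p
  cells⇒word {suc m} F {suc _} least with () ← least zero
  cells⇒word {suc m} F {zero} {suc a′} {zero} least _ _ _ Fa _ Fc = ⊥-elim (arm≢leg (trans (sym Fa) Fc))
  cells⇒word {suc m} F {zero} {suc a′} {suc c} {suc d} _ _ (s≤s a′<d) (s≤s c<d) Fa Fa′ Fc Fd inner-unique
    with as , bs , eq , S ← split-at-index (F ∘ suc) d
    with q , refl ← without-inner as (λ inner∈ → let i , lt , Fi = Split.before⁻ S inner∈ in
           Fin.<-irrefl (Fin.suc-injective (inner-unique Fi)) lt)
    with v , refl ← without-inner bs (λ inner∈ → let i , lt , Fi = Split.after⁻ S inner∈ in
           Fin.<-irrefl (sym (Fin.suc-injective (inner-unique Fi))) lt)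
    = reverse q , v , trans (cong₂ _∷_ Fa (trans eq (cong (λ κ → map ι q ++ κ ∷ map ι v) Fd))) (word-split q v) ,
      Any.reverse⁺ (ι∈⇒∈ q (subst (_∈ map ι q) Fa′ (Split.before⁺ S a′<d))) ,
      Any.reverse⁺ (ι∈⇒∈ q (subst (_∈ map ι q) Fc (Split.before⁺ S c<d)))

  module _ {arms : List (Fin n)} {c d cs} (H : IsNearHook arms c d cs) where
    open IsNearHook H

    private
      cell : ∀ {i} → Dec (i ∈ arms) → Dec (i ≡ d) → Cell
      cell (yes _) _       = arm
      cell (no _)  (yes _) = inner
      cell (no _)  (no _)  = leg

      F : Fin n → Cell
      F i = cell (i ∈? arms) (i Fin.≟ d)

      arms∌ : ∀ {i} → i ∈ arms → i ∉ c ∷ d ∷ cs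
      arms∌ = unique-++-disjoint arms nonrepeating

      d∉legs : d ∉ c ∷ cs
      d∉legs (here d≡c) = Fin.<-irrefl (sym d≡c) c<d
      d∉legs (there d∈) with _ ∷ d≢ ∷ _ ← unique-++⁻ʳ arms nonrepeating = All.lookup d≢ d∈ refl

      legs⊆ : ∀ {i} → i ∈ c ∷ cs → i ∈ c ∷ d ∷ cs
      legs⊆ (here eq)  = here eq
      legs⊆ (there i∈) = there (there i∈)

      F-arm⁺ : ∀ {i} → i ∈ arms → F i ≡ arm
      F-arm⁺ {i} i∈ with i ∈? arms
      ... | yes _ = refl
      ... | no i∉ = ⊥-elim (i∉ i∈)

      F-arm⁻ : ∀ {i} → F i ≡ arm → i ∈ arms
      F-arm⁻ {i} _ with i ∈? arms | i Fin.≟ d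
      F-arm⁻ _  | yes i∈ | _     = i∈
      F-arm⁻ () | no _   | yes _
      F-arm⁻ () | no _   | no _

      F-inner⁺ : F d ≡ inner
      F-inner⁺ with d ∈? arms | d Fin.≟ d
      ... | yes d∈ | _     = ⊥-elim (arms∌ d∈ (there (here refl)))
      ... | no _   | yes _ = refl
      ... | no _   | no ≢  = ⊥-elim (≢ refl)

      F-inner⁻ : ∀ {i} → F i ≡ inner → i ≡ d
      F-inner⁻ {i} _ with i ∈? arms | i Fin.≟ d
      F-inner⁻ () | yes _ | _
      F-inner⁻ _  | no _  | yes eq = eq
      F-inner⁻ () | no _  | no _

      F-leg⁺ : ∀ {i} → i ∈ c ∷ cs → F i ≡ leg
      F-leg⁺ {i} i∈ with i ∈? arms | i Fin.≟ d
      ... | yes i∈′ | _        = ⊥-elim (arms∌ i∈′ (legs⊆ i∈))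
      ... | no _    | yes refl = ⊥-elim (d∉legs i∈)
      ... | no _    | no _     = refl

      F-leg⁻ : ∀ {i} → F i ≡ leg → i ∈ c ∷ cs
      F-leg⁻ {i} Fi with ∈-++⁻ arms (complete i)
      ... | inj₁ i∈                = ⊥-elim (arm≢leg (trans (sym (F-arm⁺ i∈)) Fi))
      ... | inj₂ (here eq)         = here eq
      ... | inj₂ (there (here refl)) = ⊥-elim (leg≢inner (trans (sym Fi) F-inner⁺))
      ... | inj₂ (there (there i∈)) = there i∈

      isTableau : IsTableau F (nearHook arms c d cs)
      isTableau = c , d , cs , cong (λ zs → nearHook zs c d cs) (sym (entries-≡ arms-sorted F-arm⁺ F-arm⁻)) ,
        entries-≡ legs-sorted F-leg⁺ F-leg⁻ ,
        entries-≡ ([] ∷ []) (λ { (here refl) → F-inner⁺ }) (here ∘ F-inner⁻) , c<d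

      arms-∷ : Sorted (a ∷ a′ ∷ as)
      arms-∷ = subst Sorted arms≡ arms-sorted

      a<a′ : a < a′
      a<a′ with (lt ∷ _) ∷ _ ← arms-∷ = lt

      a≤ : ∀ (i : Fin n) → a ≤ i
      a≤ i with ∈-++⁻ arms (complete i)
      ... | inj₁ i∈                  = sorted-head arms-∷ (subst (i ∈_) arms≡ i∈)
      ... | inj₂ (here refl)         = ℕ.<⇒≤ a<c
      ... | inj₂ (there (here refl)) = ℕ.<⇒≤ (ℕ.<-trans a<c c<d)
      ... | inj₂ (there (there i∈))  =
        ℕ.≤-trans (ℕ.<⇒≤ a<c) (sorted-head legs-sorted (there i∈))

      first-arms : ∀ {i} → i ∈ a ∷ a′ ∷ as → F i ≡ arm
      first-arms i∈ = F-arm⁺ (subst (_ ∈_) (sym arms≡) i∈)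

    nearHook⇒word : ∃₂ λ p v → Encodes p v (nearHook arms c d cs) × false ∈ p × true ∈ p
    nearHook⇒word
      with p , v , eq , false∈ , true∈ ← cells⇒word F a≤ a<a′ a′<d c<d
             (first-arms (here refl)) (first-arms (there (here refl))) (F-leg⁺ (here refl)) F-inner⁺ F-inner⁻
      = p , v , (F , eq , isTableau) , false∈ , true∈

  two-smallest : ∀ {xs : List (Fin (suc m))} {j} → Sorted xs → zero ∈ xs → suc j ∈ xs →
                 ∃₂ λ y ys → xs ≡ zero ∷ y ∷ ys × y ≤ suc j
  two-smallest {xs = x ∷ xs} xs↗ zero∈ j∈ with sorted-head xs↗ zero∈
  two-smallest {xs = zero ∷ xs} _ _ (here ()) | _
  two-smallest {xs = zero ∷ y ∷ ys} (_ ∷ xs↗) _ (there j∈) | _ = y , ys , refl , sorted-head xs↗ j∈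

  smallest : ∀ {xs : List (Fin n)} {j} → Sorted xs → j ∈ xs → ∃₂ λ y ys → xs ≡ y ∷ ys × y ≤ j
  smallest {xs = y ∷ ys} xs↗ j∈ = y , ys , refl , sorted-head xs↗ j∈

  tabulate-surjective : (xs : List A) → length xs ≡ n → ∃ λ (F : Fin n → A) → tabulate F ≡ xs
  tabulate-surjective xs refl = List.lookup xs , tabulate-lookup xs

  -- The two letters of `p` give a non-least arm and a leg before the entry of (2,2). The second
  -- smallest arm and the smallest leg are at most these, which settles both comparisons at (2,2);
  -- the rows and the column are increasing by construction.
  cells⇒nearHook : (F : Fin n → Cell) → ∀ {p v} → tabulate F ≡ word p v → false ∈ p → true ∈ p →
                   ∃ λ T → T ∈ 𝒯 n × IsTableau F T
  cells⇒nearHook {suc m} F {p} {v} eq false∈ true∈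
    with d , Fd , S ← index-of-split (F ∘ suc) (reverse (map ι p)) (trans (∷-injectiveʳ eq) (ʳ++-defn (map ι p)))
    with i , i<d , Fi ← Split.before⁻ S (Any.reverse⁺ (∈-map⁺ ι false∈))
    with j , j<d , Fj ← Split.before⁻ S (Any.reverse⁺ (∈-map⁺ ι true∈))
    with a′ , as , arms≡ , a′≤ ← two-smallest (entries-sorted {F = F} arm)
           (∈-entries⁺ {F = F} (∷-injectiveˡ eq)) (∈-entries⁺ {F = F} Fi)
    with c , cs , legs≡ , c≤ ← smallest (entries-sorted {F = F} leg) (∈-entries⁺ {F = F} Fj)
    = nearHook (entries arm F) c (suc d) cs , nearHook⇒∈-𝒯 hook ,
      c , suc d , cs , refl , legs≡ , inner≡ , c<d
    where
    F-inner⁻ : ∀ {k} → F k ≡ inner → k ≡ suc d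
    F-inner⁻ {zero}  Fk = ⊥-elim (arm≢inner (trans (sym (∷-injectiveˡ eq)) Fk))
    F-inner⁻ {suc k} Fk with Fin.<-cmp k d
    ... | tri≈ _ refl _ = refl
    ... | tri< k<d _ _  with _ , _ , eq ← ∈-map⁻ ι (Any.reverse⁻ {xs = map ι p} (Split.before⁺ S k<d)) =
      ⊥-elim (ι≢inner (trans (sym eq) Fk))
    ... | tri> _ _ d<k  with _ , _ , eq ← ∈-map⁻ ι (Split.after⁺ S d<k) =
      ⊥-elim (ι≢inner (trans (sym eq) Fk))

    inner≡ : entries inner F ≡ suc d ∷ []
    inner≡ = entries-≡ ([] ∷ []) (λ { (here refl) → Fd }) (here ∘ F-inner⁻)

    leg⁻ : ∀ {k} → k ∈ c ∷ cs → F k ≡ leg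
    leg⁻ {k} k∈ = ∈-entries⁻ {F = F} (subst (k ∈_) (sym legs≡) k∈)

    c<d : c < suc d
    c<d = ℕ.≤-<-trans c≤ (s≤s j<d)

    0<c : ∀ {k} → F k ≡ leg → zero {n = m} < k
    0<c {zero}  Fk = ⊥-elim (arm≢leg (trans (sym (∷-injectiveˡ eq)) Fk))
    0<c {suc _} _  = s≤s z≤n

    legs-sorted : Sorted (c ∷ cs)
    legs-sorted = subst Sorted legs≡ (entries-sorted {F = F} leg)

    column-unique : Unique (c ∷ suc d ∷ cs)
    column-unique with c≢ ∷ cs! ← sorted⇒unique legs-sorted =
      (Fin.<⇒≢ c<d ∷ c≢) ∷ All.tabulate (λ { k∈ refl → leg≢inner (trans (sym (leg⁻ (there k∈))) Fd) }) ∷ cs!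

    arm∉column : ∀ {k} → ¬ (k ∈ entries arm F × k ∈ c ∷ suc d ∷ cs)
    arm∉column (k∈ , here refl)         = arm≢leg (trans (sym (∈-entries⁻ {F = F} k∈)) (leg⁻ (here refl)))
    arm∉column (k∈ , there (here refl)) = arm≢inner (trans (sym (∈-entries⁻ {F = F} k∈)) Fd)
    arm∉column (k∈ , there (there k∈′)) = arm≢leg (trans (sym (∈-entries⁻ {F = F} k∈)) (leg⁻ (there k∈′)))

    covered : ∀ k → k ∈ entries arm F ++ c ∷ suc d ∷ cs
    covered k with F k in Fk
    ... | arm   = ∈-++⁺ˡ (∈-entries⁺ {F = F} Fk)
    ... | inner = ∈-++⁺ʳ (entries arm F) (there (here (F-inner⁻ Fk)))
    ... | leg with subst (k ∈_) legs≡ (∈-entries⁺ {F = F} Fk)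
    ... | here k≡  = ∈-++⁺ʳ (entries arm F) (here k≡)
    ... | there k∈ = ∈-++⁺ʳ (entries arm F) (there (there k∈))

    hook : IsNearHook (entries arm F) c (suc d) cs
    hook = record
      { arms≡ = arms≡ ; arms-sorted = entries-sorted {F = F} arm ; legs-sorted = legs-sorted
      ; a<c = 0<c (leg⁻ (here refl)) ; a′<d = ℕ.≤-<-trans a′≤ (s≤s i<d) ; c<d = c<d
      ; nonrepeating = Unique.++⁺ (sorted⇒unique (entries-sorted {F = F} arm)) column-unique arm∉column
      ; complete = covered }

  encoded-tableau : ∀ p v → length (word p v) ≡ n → false ∈ p → true ∈ p →
                    ∃ λ (T : Filling n) → T ∈ 𝒯 n × Encodes p v T
  encoded-tableau p v len false∈ true∈
    with F , eq ← tabulate-surjective (word p v) len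
    with T , T∈ , tableau ← cells⇒nearHook F eq false∈ true∈ = T , T∈ , F , eq , tableau

  𝒯-encoded : ∀ {T : Filling n} → T ∈ 𝒯 n → ∃₂ λ p v → Encodes p v T × false ∈ p × true ∈ p
  𝒯-encoded T∈ with _ , _ , _ , _ , refl , hook ← ∈-𝒯⇒nearHook T∈ = nearHook⇒word hook

  entries-cong : ∀ κ {F G : Fin n → Cell} → (∀ i → F i ≡ G i) → entries κ F ≡ entries κ G
  entries-cong κ F≗G = filter-≐ _ _ ((λ {i} eq → trans (sym (F≗G i)) eq) , (λ {i} eq → trans (F≗G i) eq))
    (allFin _)

  tabulate-injective : {F G : Fin n → A} → tabulate F ≡ tabulate G → ∀ i → F i ≡ G i
  tabulate-injective eq zero    = ∷-injectiveˡ eq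
  tabulate-injective eq (suc i) = tabulate-injective (∷-injectiveʳ eq) i

  encodes-functional : ∀ {p v} {T T′ : Filling n} → Encodes p v T → Encodes p v T′ → T ≡ T′
  encodes-functional (F , eq , _ , _ , _ , refl , legs , inners , _)
    (G , eq′ , _ , _ , _ , refl , legs′ , inners′ , _)
    with F≗G ← tabulate-injective {F = F} {G} (trans eq (sym eq′))
    with refl , refl ← ∷-injective (trans (sym legs) (trans (entries-cong leg F≗G) legs′))
       | refl ← ∷-injectiveˡ (trans (sym inners) (trans (entries-cong inner F≗G) inners′))
    = cong (λ zs → nearHook zs _ _ _) (entries-cong arm F≗G)

  nearHook-injective : ∀ {arms c d cs arms′ c′ d′} {cs′ : List (Fin n)} →
    nearHook arms c d cs ≡ nearHook arms′ c′ d′ cs′ → arms ≡ arms′ × c ≡ c′ × d ≡ d′ × cs ≡ cs′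
  nearHook-injective eq with arms≡ , eq₁ ← ∷-injective eq with cd≡ , cs≡ ← ∷-injective eq₁ =
    arms≡ , ∷-injectiveˡ cd≡ , ∷-injectiveˡ (∷-injectiveʳ cd≡) , map-injective ∷-injectiveˡ cs≡

  no-inner : ∀ q → All (_≢ inner) (map ι q)
  no-inner q = All.map⁺ (All.universal (λ _ → ι≢inner) q)

  word-injective : ∀ {p v p′ v′} → word p v ≡ word p′ v′ → p ≡ p′ × v ≡ v′
  word-injective {p} {v} {p′} {v′} eq
    with p≡ , _ , v≡ ← first-occurrenceʳ {P = _≡ inner} (no-inner p) (no-inner p′) refl refl (∷-injectiveʳ eq)
    = map-injective ι-injective p≡ , map-injective ι-injective v≡

  -- The tableau returns the set of entries of each type, hence `F`, and the first `inner` in its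
  -- word shows where `p` ends.
  encodes-injective : ∀ {p v p′ v′} {T : Filling n} → Encodes p v T → Encodes p′ v′ T → p ≡ p′ × v ≡ v′
  encodes-injective (F , eq , _ , _ , _ , refl , legs , inners , _)
    (G , eq′ , _ , _ , _ , T≡ , legs′ , inners′ , _)
    with arms≡ , refl , refl , refl ← nearHook-injective T≡ =
    word-injective (trans (sym eq) (trans (tabulate-cong F≗G) eq′))
    where
    entries≡ : ∀ κ → entries κ F ≡ entries κ G
    entries≡ arm   = arms≡
    entries≡ leg   = trans legs (sym legs′)
    entries≡ inner = trans inners (sym inners′)
    F≗G : ∀ i → F i ≡ G i
    F≗G i = sym (∈-entries⁻ {F = G} (subst (i ∈_) (entries≡ (F i)) (∈-entries⁺ {F = F} refl)))

  -- Descents of a tableau in terms of cell types.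

  isDescent : Cell → Cell → Bool
  isDescent _   leg   = true
  isDescent arm inner = true
  isDescent _   _     = false

  isDescent-ι : ∀ κ b → isDescent κ (ι b) ≡ b
  isDescent-ι arm   false = refl
  isDescent-ι leg   false = refl
  isDescent-ι inner false = refl
  isDescent-ι κ     true  = refl

  -- Each `ι b` contributes the bit `b` whatever precedes it. The cell `inner` is a descent exactly
  -- after an arm, so its bit is opposite to the preceding `y`; this is the alternation it marks.
  -- The initial `arm` has no predecessor and contributes no bit.
  descents-word : ∀ y p v → consecutive isDescent (word (y ∷ p) v) ≡ (not y ∷ y ∷ p) ʳ++ v
  descents-word y p v = begin
    consecutive isDescent (word (y ∷ p) v)
      ≡⟨ cong (consecutive isDescent) (++-ʳ++ (map ι (y ∷ p))) ⟨
    consecutive isDescent ((map ι (y ∷ p) ++ arm ∷ []) ʳ++ (inner ∷ map ι v))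
      ≡⟨ consecutive-ʳ++ isDescent (map ι (y ∷ p) ++ arm ∷ []) ⟩
    consecutive (flip isDescent) (inner ∷ map ι (y ∷ p) ++ arm ∷ []) ʳ++ consecutive isDescent (inner ∷ map ι v)
      ≡⟨ cong₂ _ʳ++_ (cong₂ _∷_ (link y) (before (y ∷ p))) (after inner v) ⟩
    (not y ∷ y ∷ p) ʳ++ v ∎
    where
    open ≡-Reasoning
    link : ∀ y → isDescent (ι y) inner ≡ not y
    link false = refl
    link true  = refl
    before : ∀ q → consecutive (flip isDescent) (map ι q ++ arm ∷ []) ≡ q
    before []          = refl
    before (b ∷ [])    = cong (_∷ []) (isDescent-ι arm b)
    before (b ∷ b′ ∷ q) = cong₂ _∷_ (isDescent-ι (ι b′) b) (before (b′ ∷ q))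
    after : ∀ κ q → consecutive isDescent (κ ∷ map ι q) ≡ q
    after κ []      = refl
    after κ (b ∷ q) = cong₂ _∷_ (isDescent-ι κ b) (after (ι b) q)

  single-row⁺ : ∀ {cs : List (Fin n)} {i} → i ∈ cs → ∃ λ r → i ∈ List.lookup (map [_] cs) r
  single-row⁺ (here refl) = zero , here refl
  single-row⁺ (there i∈) with r , i∈′ ← single-row⁺ i∈ = suc r , i∈′

  single-row⁻ : ∀ (cs : List (Fin n)) {i} r → i ∈ List.lookup (map [_] cs) r → i ∈ cs
  single-row⁻ (c ∷ cs) zero    (here refl) = here refl
  single-row⁻ (c ∷ cs) (suc r) i∈          = there (single-row⁻ cs r i∈)

  single-row-< : ∀ {cs : List (Fin n)} {i j} → Sorted cs → i ∈ cs → j ∈ cs → i < j →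
                 ∃₂ λ r s → r < s × i ∈ List.lookup (map [_] cs) r × j ∈ List.lookup (map [_] cs) s
  single-row-< _ (here refl) (here refl) lt = ⊥-elim (Fin.<-irrefl refl lt)
  single-row-< _ (here refl) (there j∈) lt with s , j∈′ ← single-row⁺ j∈ =
    zero , suc s , s≤s z≤n , here refl , j∈′
  single-row-< (c< ∷ _) (there i∈) (here refl) lt = ⊥-elim (ℕ.<-asym lt (All.lookup c< i∈))
  single-row-< (_ ∷ cs↗) (there i∈) (there j∈) lt with r , s , r<s , i∈′ , j∈′ ← single-row-< cs↗ i∈ j∈ lt =
    suc r , suc s , s≤s r<s , i∈′ , j∈′

  module _ {F : Fin n → Cell} {c d : Fin n} {cs} (legs≡ : entries leg F ≡ c ∷ cs)
           (inner≡ : entries inner F ≡ d ∷ []) (c<d : c < d) where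
    private
      T = nearHook (entries arm F) c d cs

      leg⁻ : ∀ {i} → i ∈ c ∷ cs → F i ≡ leg
      leg⁻ {i} i∈ = ∈-entries⁻ {F = F} (subst (i ∈_) (sym legs≡) i∈)

      leg⁺ : ∀ {i} → F i ≡ leg → i ∈ c ∷ cs
      leg⁺ {i} Fi = subst (i ∈_) legs≡ (∈-entries⁺ {F = F} Fi)

      inner⁻ : F d ≡ inner
      inner⁻ = ∈-entries⁻ {F = F} (subst (d ∈_) (sym inner≡) (here refl))

      inner⁺ : ∀ {i} → F i ≡ inner → i ≡ d
      inner⁺ {i} Fi with here eq ← subst (i ∈_) inner≡ (∈-entries⁺ {F = F} Fi) = eq

      legs-sorted : Sorted (c ∷ cs)
      legs-sorted = subst Sorted legs≡ (entries-sorted {F = F} leg)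

    descentᵀ⁻ : ∀ i → IsDescentᵀ T i → ∃ λ j → toℕ j ≡ suc (toℕ i) × isDescent (F i) (F j) ≡ true
    descentᵀ⁻ i (j , j≡ , r , s , r<s , i∈ , j∈) = j , j≡ , go r s r<s i∈ j∈
      where
      to-leg : F j ≡ leg → isDescent (F i) (F j) ≡ true
      to-leg Fj rewrite Fj = refl
      go : ∀ r s → r < s → i ∈ List.lookup T r → j ∈ List.lookup T s → isDescent (F i) (F j) ≡ true
      go zero (suc zero)          _  i∈ (here refl)         = to-leg (leg⁻ (here refl))
      go zero (suc zero)          _  i∈ (there (here refl)) = cong₂ isDescent (∈-entries⁻ {F = F} i∈) inner⁻
      go (suc r) (suc zero)       (s≤s ())
      go r    (suc (suc s))       _  i∈ j∈                  = to-leg (leg⁻ (there (single-row⁻ cs s j∈)))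

    descentᵀ⁺ : ∀ i {j} → toℕ j ≡ suc (toℕ i) → isDescent (F i) (F j) ≡ true → IsDescentᵀ T i
    descentᵀ⁺ i {j} j≡ eq = j , j≡ , go (F i) (F j) refl refl eq
      where
      i<j : i < j
      i<j = ℕ.≤-reflexive (sym j≡)
      Rows = ∃₂ λ r s → r < s × i ∈ List.lookup T r × j ∈ List.lookup T s
      below : i ∈ c ∷ d ∷ [] → j ∈ cs → Rows
      below i∈ j∈ with s , j∈′ ← single-row⁺ j∈ = suc zero , suc (suc s) , s≤s (s≤s z≤n) , i∈ , j∈′
      leg-leg : i ∈ c ∷ cs → j ∈ c ∷ cs → Rows
      leg-leg (here refl) (here refl) = ⊥-elim (Fin.<-irrefl refl i<j)
      leg-leg (here refl) (there j∈)  = below (here refl) j∈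
      leg-leg (there i∈)  j∈ with legs-sorted | j∈
      ... | c< ∷ _   | here refl = ⊥-elim (ℕ.<-asym i<j (All.lookup c< i∈))
      ... | _ ∷ cs↗ | there j∈′ with r , s , r<s , i∈″ , j∈″ ← single-row-< cs↗ i∈ j∈′ i<j =
        suc (suc r) , suc (suc s) , s≤s (s≤s r<s) , i∈″ , j∈″
      go : ∀ κ κ′ → F i ≡ κ → F j ≡ κ′ → isDescent κ κ′ ≡ true → Rows
      go arm inner Fi Fj _ =
        zero , suc zero , s≤s z≤n , ∈-entries⁺ {F = F} Fi , there (here (inner⁺ Fj))
      go arm leg Fi Fj _ with leg⁺ Fj
      ... | here j≡c = zero , suc zero , s≤s z≤n , ∈-entries⁺ {F = F} Fi , here j≡c
      ... | there j∈ with s , j∈′ ← single-row⁺ j∈ =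
        zero , suc (suc s) , s≤s z≤n , ∈-entries⁺ {F = F} Fi , j∈′
      go leg leg Fi Fj _ = leg-leg (leg⁺ Fi) (leg⁺ Fj)
      -- The row of `d` also contains the leg `c`, but `c` is too small to come after `d`.
      go inner leg Fi Fj _ with refl ← inner⁺ Fi with leg⁺ Fj
      ... | here refl = ⊥-elim (ℕ.<-asym i<j c<d)
      ... | there j∈  = below (there (here refl)) j∈

  encoded-descentᵀ⇒At : ∀ {y p v} {T : Filling n} → Encodes (y ∷ p) v T → ∀ i →
                        IsDescentᵀ T i → At ((not y ∷ y ∷ p) ʳ++ v) (toℕ i)
  encoded-descentᵀ⇒At {y = y} {p} {v} (F , eq , c , d , cs , refl , legs≡ , inner≡ , c<d) i des
    with j , j≡ , b ← descentᵀ⁻ {F = F} legs≡ inner≡ c<d i des =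
    subst (λ bs → At bs (toℕ i)) (trans (cong (consecutive isDescent) eq) (descents-word y p v))
      (At-consecutive⁺ isDescent F j≡ b)

  At⇒encoded-descentᵀ : ∀ {y p v} {T : Filling n} → Encodes (y ∷ p) v T → ∀ i →
                        At ((not y ∷ y ∷ p) ʳ++ v) (toℕ i) → IsDescentᵀ T i
  At⇒encoded-descentᵀ {y = y} {p} {v} (F , eq , c , d , cs , refl , legs≡ , inner≡ , c<d) i at
    with j , j≡ , b ← At-consecutive⁻ isDescent F i (subst (λ bs → At bs (toℕ i))
           (sym (trans (cong (consecutive isDescent) eq) (descents-word y p v))) at) =
    descentᵀ⁺ {F = F} legs≡ inner≡ c<d i j≡ b

-- The bijection between tableaux and permutations.

open ArcPermutations
open NearHooks
open import Data.Nat using (_≤_; _<_)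

∈-𝒵⁺ : ∀ {y w h} {π : Word n} → IsLayout n (values π) y w h → π ∈ 𝒵 n
∈-𝒵⁺ {n} {y} {w} {h} {π} (eq , y∈ , refl) =
  ∈-filter⁺ _ (∈-filter⁺ isPermutation? (∈-allVecs π) (arrangement⇒permutation π p))
    (arc⇒isArc π p (subst Arc (sym eq) (layout-arc y w h)) , λ where
      (inj₁ prefixes) → layout-¬prefixConvex y w h y∈ (subst PrefixConvex eq (prefixes⇒prefixConvex π p prefixes))
      (inj₂ suffixes) → layout-¬suffixConvex y w h (subst SuffixConvex eq (suffixes⇒suffixConvex π p suffixes)))
  where
  p = subst (Arrangement n) (sym eq) (layout-arrangement y w h)

∈-𝒵⁻ : ∀ {π : Word n} → 2 ≤ n → π ∈ 𝒵 n → ∃ λ y → ∃₂ λ w h → IsLayout n (values π) y w h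
∈-𝒵⁻ {n} {π} 2≤n π∈
  with π∈𝒮 , arc , ¬unimodal ← ∈-filter⁻ (λ π → isArc? π ×-dec ¬? (isUnimodal? π)) {xs = 𝒮 n} π∈
  with p ← permutation⇒arrangement π (proj₂ (∈-filter⁻ isPermutation? {xs = allVecs (allFin n) n} π∈𝒮))
  = arc⇒layout p 2≤n (isArc⇒arc π p arc) (¬unimodal ∘ inj₁ ∘ prefixConvex⇒prefixes π p)
      (¬unimodal ∘ inj₂ ∘ suffixConvex⇒suffixes π p)

𝒵-unique : ∀ n → Unique (𝒵 n)
𝒵-unique n = Unique.filter⁺ _ (Unique.filter⁺ isPermutation? (allVecs-unique (Unique.allFin⁺ n) n))

-- The letters between the two marked alternations, a run of q + 1 letters y,
-- precede the marked one for the tableau and follow it for the permutation.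
run : Bool → ℕ → List Bool → List Bool
run y q v = replicate q y ++ not y ∷ v

-- The letters of the tableau before its cut are descent bits, those of the permutation are peeled
-- backwards and come out negated; `map not` reconciles the two.
Corresponds : Filling n → Word n → Set
Corresponds {n} T π = ∃₂ λ y q → ∃₂ λ u v →
  Encodes (y ∷ run y q u) v T × IsLayout n (values π) y (map not u) (run y q v)

map-not-involutive : ∀ w → map not (map not w) ≡ w
map-not-involutive w = trans (sym (map-∘ w)) (trans (map-cong Bool.not-involutive w) (map-id w))

map-not-surjective : ∀ w → ∃ λ u → w ≡ map not u
map-not-surjective w = map not w , sym (map-not-involutive w)

length-run : ∀ y q v → length (run y q v) ≡ suc (q + length v)
length-run y q v = trans (length-++ (replicate q y))
  (trans (cong (_+ suc (length v)) (length-replicate q)) (ℕ.+-suc q _))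

sizes : ∀ y q u v →
  length (word (y ∷ run y q u) v) ≡ 3 + (length (map not u) + length (run y q v))
sizes y q u v = begin
  suc (length (map ι (y ∷ run y q u) ʳ++ (inner ∷ map ι v)))
    ≡⟨ cong suc (length-ʳ++ (map ι (y ∷ run y q u))) ⟩
  suc (length (map ι (y ∷ run y q u)) + suc (length (map ι v)))
    ≡⟨ cong₂ (λ a b → suc (a + suc b))
         (trans (length-map ι (y ∷ run y q u)) (cong suc (length-run y q u))) (length-map ι v) ⟩
  suc (suc (suc (q + length u)) + suc (length v))
    ≡⟨ regroup q (length u) (length v) ⟩
  3 + (length u + suc (q + length v))
    ≡⟨ cong₂ (λ a b → 3 + (a + b)) (length-map not u) (length-run y q v) ⟨
  3 + (length (map not u) + length (run y q v)) ∎
  where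
  open ≡-Reasoning
  regroup : ∀ q a b → suc (suc (suc (q + a)) + suc b) ≡ 3 + (a + suc (q + b))
  regroup = solve-∀

alternates : ∀ y {p} → not y ∈ p → false ∈ y ∷ p × true ∈ y ∷ p
alternates false y∈ = here refl , there y∈
alternates true  y∈ = there y∈ , here refl

alternates⁻ : ∀ y {p} → false ∈ y ∷ p → true ∈ y ∷ p → not y ∈ p
alternates⁻ false _ (there t∈) = t∈
alternates⁻ true  (there f∈) _ = f∈

not∈run : ∀ y q v → not y ∈ run y q v
not∈run y q v = ∈-++⁺ʳ (replicate q y) (here refl)

∷-replicate : ∀ q (y : Bool) {xs} → y ∷ replicate q y ++ xs ≡ replicate q y ++ y ∷ xs
∷-replicate zero    y = refl
∷-replicate (suc q) y = cong (y ∷_) (∷-replicate q y)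

-- Both sides spell the reverse of `u`, then `not y`, a run of `q + 1` letters `y`, `not y`, and
-- `v`. The tableau is marked at the change that ends the run, the permutation at the change that
-- begins it.
descents≡ : ∀ y q u v →
  (not y ∷ y ∷ run y q u) ʳ++ v ≡ (y ∷ not y ∷ map not (map not u)) ʳ++ run y q v
descents≡ y q u v = begin
  (y ∷ run y q u) ʳ++ (not y ∷ v)
    ≡⟨ cong (_ʳ++ (not y ∷ v)) (∷-replicate q y) ⟩
  (replicate q y ++ y ∷ not y ∷ u) ʳ++ (not y ∷ v)
    ≡⟨ replicate-ʳ++ q y ⟨
  (y ∷ not y ∷ u) ʳ++ run y q v
    ≡⟨ cong (λ w → (y ∷ not y ∷ w) ʳ++ run y q v) (map-not-involutive u) ⟨
  (y ∷ not y ∷ map not (map not u)) ʳ++ run y q v ∎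
  where open ≡-Reasoning

corresponding-word : ∀ {T : Filling n} → T ∈ 𝒯 n → ∃ λ π → π ∈ 𝒵 n × Corresponds T π
corresponding-word {n} T∈ with 𝒯-encoded T∈
... | y ∷ p , v , enc@(F , eq , _) , f∈ , t∈
  -- Both letters occur before the entry of (2,2), so going back from it the run of `y` meets a
  -- `not y`: the previous alternation.
  with q , u , refl ← split-first-not y (alternates⁻ y f∈ t∈)
  with n≡ ← trans (sym (length-tabulate F)) (trans (cong length eq) (sizes y q u v))
  with π , π≡ ← values-surjective {n = n}
         (trans (Arrangement.size (layout-arrangement y (map not u) (run y q v))) (sym n≡))
         (λ v∈ → subst (_ <_) (sym n≡) (Arrangement.bounded (layout-arrangement y (map not u) (run y q v))
            v∈))
  with isLayout ← (π≡ , not∈run y q v , n≡)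
  = π , ∈-𝒵⁺ isLayout , y , q , u , v , enc , isLayout

corresponding-tableau : ∀ {π : Word n} → 2 ≤ n → π ∈ 𝒵 n → ∃ λ T → T ∈ 𝒯 n × Corresponds T π
corresponding-tableau 2≤n π∈ with y , w , h , eq , y∈ , n≡ ← ∈-𝒵⁻ 2≤n π∈
  -- Non-unimodality has put a `not y` into `h`; its first occurrence is the next alternation.
  with q , v , refl ← split-first-not y y∈
  with u , refl ← map-not-surjective w
  with f∈ , t∈ ← alternates y (not∈run y q u)
  with T , T∈ , enc ← encoded-tableau (y ∷ run y q u) v (trans (sizes y q u v) (sym n≡)) f∈ t∈
  = T , T∈ , y , q , u , v , enc , eq , y∈ , n≡

corresponds-functional : ∀ {T : Filling n} {π π′ : Word n} → Corresponds T π → Corresponds T π′ → π ≡ π′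
corresponds-functional (y , q , u , v , enc , eq , _) (y′ , q′ , u′ , v′ , enc′ , eq′ , _)
  with p≡ , refl ← encodes-injective {p = y ∷ run y q u} {v} {y′ ∷ run y′ q′ u′} {v′} enc enc′
  with refl ← ∷-injectiveˡ p≡
  with refl , refl ← replicate-∷-injective y q q′ (∷-injectiveʳ p≡)
  = values-injective (trans eq (sym eq′))

corresponds-injective : ∀ {T T′ : Filling n} {π : Word n} → Corresponds T π → Corresponds T′ π → T ≡ T′
corresponds-injective (y , q , u , v , enc , L) (y′ , q′ , u′ , v′ , enc′ , L′)
  with refl , w≡ , h≡ ← layout-injective y _ _ y′ _ _ L L′
  with refl ← map-injective Bool.not-injective w≡
  with refl , refl ← replicate-∷-injective y q q′ h≡
  = encodes-functional {p = y ∷ run y q u} {v} enc enc′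

corresponds⇒Des : ∀ (T : Filling n) (π : Word n) → Corresponds T π → Desᵀ T ≡ Des π
corresponds⇒Des T π (y , q , u , v , enc , eq , _) =
  filter-≐ (isDescentᵀ? T) (isDescent? π)
    ( (λ {i} des → At⇒descent π i (subst (λ bs → At bs (toℕ i)) bits≡
        (encoded-descentᵀ⇒At {p = run y q u} {v} enc i des)))
    , (λ {i} des → At⇒encoded-descentᵀ {p = run y q u} {v} enc i (subst (λ bs → At bs (toℕ i)) (sym bits≡)
        (descent⇒At π i des))) )
    (allFin _)
  where
  bits≡ : (not y ∷ y ∷ run y q u) ʳ++ v ≡ consecutive _>ᵇ_ (values π)
  bits≡ = trans (descents≡ y q u v)
    (sym (trans (cong (consecutive _>ᵇ_) eq) (descents-layout y (map not u) (run y q v))))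

theorem7p7 : ∀ (n : ℕ) → 4 ≤ n → ∑ (𝒯 n) (λ T → 𝐱^ (Desᵀ T)) ≈ ∑ (𝒵 n) (λ π → 𝐱^ (Des π))
theorem7p7 n 4≤n = ∑-↭ {f = λ T → 𝐱^ (Desᵀ T)} {g = λ π → 𝐱^ (Des π)}
  (map-↭-bijection Corresponds (𝒯-unique n) (𝒵-unique n)
    corresponding-word (corresponding-tableau (ℕ.≤-trans (s≤s (s≤s z≤n)) 4≤n))
    (λ {T} → corresponds-functional {T = T}) (λ {T} {T′} {π} → corresponds-injective {T = T} {T′} {π})
    _ _ (λ {T} {π} → cong 𝐱^ ∘ corresponds⇒Des T π))
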